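{- The transience class of the Abelian sandpile model on the $n \times n$ grid $\square_n$ satisfies $\mathrm{tcl}(\square_n) = O(n^{4}\log^4 n)$ as $n\to\infty$.
   Context: The graph $\square_n$ has vertex set $\{1,\dots,n\}^2 \cup \{s\}$, where $s$ is a sink vertex. Two non-sink vertices are joined by an edge if they differ by exactly $1$ in exactly one coordinate. Each boundary vertex is joined to $s$ by additional (possibly parallel) edges so that every non-sink vertex has degree exactly $4$. Abelian sandpile model on a finite multigraph $G$ with sink $s$: a configuration assigns a nonnegative integer number of grains $\sigma(v)$ to each non-sink vertex $v$. A non-sink vertex $v$ with $\sigma(v)\ge \deg(v)$ may topple, sending one grain along each incident edge; grains sent to $s$ disappear. A configuration in which no vertex can topple is stable. Repeated toppling always terminates, and the resulting stable configuration does not depend on the order of topplings. One step of the process adds one grain at a chosen non-sink vertex and then stabilizes. A stable configuration is recurrent if it can be revisited by this process; otherwise it is transient. The transience class $\mathrm{tcl}(G)$ is the maximum number of grains that can be added, one at a time at adversarially chosen non-sink vertices and stabilizing after each addition, starting from the empty (all-zero) configuration, before the configuration necessarily becomes recurrent. -}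

module Defs where

open import Data.Nat using (ℕ; zero; suc; _+_; _*_; _∸_; _^_; _≤_; _<_; _≡ᵇ_)
open import Data.Nat.Logarithm using (⌊log₂_⌋)
open import Data.Bool using (Bool; true; false; _∧_; _∨_; if_then_else_)
open import Data.Fin using (Fin; toℕ)
open import Data.Vec using (Vec; lookup; tabulate; replicate)
open import Data.Product using (Σ; ∃; _×_)
open import Relation.Nullary using (¬_)

-- Configurations on the non-sink vertices {1..n}^2 of the grid □_n
-- (vertex (i,j) is represented by Fin n × Fin n); the sink is implicit:
-- grains sent to it simply disappear.
Conf : ℕ → Set
Conf n = Vec (Vec ℕ n) n

height : ∀ {n} → Conf n → Fin n → Fin n → ℕ
height σ i j = lookup (lookup σ i) j

empty : ∀ n → Conf n
empty n = replicate n (replicate n 0)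

sameB : ∀ {n} → Fin n → Fin n → Fin n → Fin n → Bool
sameB a b i j = (toℕ a ≡ᵇ toℕ i) ∧ (toℕ b ≡ᵇ toℕ j)

adjB : ∀ {n} → Fin n → Fin n → Fin n → Fin n → Bool
adjB a b i j =
  ((toℕ a ≡ᵇ toℕ i) ∧ ((suc (toℕ b) ≡ᵇ toℕ j) ∨ (suc (toℕ j) ≡ᵇ toℕ b)))
  ∨ ((toℕ b ≡ᵇ toℕ j) ∧ ((suc (toℕ a) ≡ᵇ toℕ i) ∨ (suc (toℕ i) ≡ᵇ toℕ a)))

-- toppling vertex (i,j): it loses 4 = deg grains, each grid neighbour gains 1,
-- the remaining grains (boundary) go to the sink.
toppleAt : ∀ {n} → Conf n → Fin n → Fin n → Conf n
toppleAt σ i j = tabulate λ a → tabulate λ b →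
  if sameB a b i j then height σ a b ∸ 4
  else (if adjB a b i j then suc (height σ a b) else height σ a b)

addAt : ∀ {n} → Conf n → Fin n → Fin n → Conf n
addAt σ i j = tabulate λ a → tabulate λ b →
  if sameB a b i j then suc (height σ a b) else height σ a b

data Topples {n : ℕ} : Conf n → Conf n → Set where
  done : ∀ {σ} → Topples σ σ
  topple : ∀ {σ τ} (i j : Fin n) → 4 ≤ height σ i j → Topples (toppleAt σ i j) τ → Topples σ τ

Stable : ∀ {n} → Conf n → Set
Stable σ = ∀ i j → height σ i j < 4

Stabilizes : ∀ {n} → Conf n → Conf n → Set
Stabilizes σ τ = Topples σ τ × Stable τ

Step : ∀ {n} → Conf n → Conf n → Set
Step σ τ = Σ _ λ i → Σ _ λ j → Stabilizes (addAt σ i j) τ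

data Steps {n : ℕ} : ℕ → Conf n → Conf n → Set where
  zero : ∀ {σ} → Steps 0 σ σ
  suc : ∀ {k σ ρ τ} → Step σ ρ → Steps k ρ τ → Steps (suc k) σ τ

Recurrent : ∀ {n} → Conf n → Set
Recurrent τ = ∃ λ k → Steps (suc k) τ τ

TclAtMost : ℕ → ℕ → Set
TclAtMost n B = ∀ k (τ : Conf n) → Steps k (empty n) τ → ¬ Recurrent τ → k < B

{-# OPTIONS --safe #-}
module Submission where

-- Let u be the number of topplings at each vertex. If every vertex has toppled, the configuration σ is recurrent:
-- after adding one grain per edge to the sink, each vertex can be toppled once, in the order of the last
-- topplings, which gives σ back. Otherwise u vanishes at some vertex, at position (a, b) from the nearest corner.
-- Since nb u ≤ 4u + 3, adding to u a supersolution of the exit time problem, of size O(ab log n), makes it strictly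
-- superharmonic. Comparison with a product p(x)p(y) that is subharmonic outside a central box shows that the
-- minimum over the box of the sum is O(n² log n). A Harnack inequality with logarithmic loss, used twice, bounds
-- u on the box by O(n² log³ n), and summation by parts against p(x)p(y) bounds the number of grains by O(n⁴ log³ n).

-- The obstacle is that the vertex where u vanishes may lie next to a side or a corner, where a
-- chain of Harnack steps would be far too lossy. Both comparison functions are therefore fitted to
-- the corner: for a, b up to the midpoint p(a)p(b) is at least a constant multiple of ab, and the
-- exit time supersolution is at most a multiple of ab log n. The factor ab cancels at (a, b), and
-- the resulting bound on the box does not depend on where that vertex is. One logarithm comes from
-- the dyadic scales of the supersolution and one from each use of the Harnack inequality, whose
-- barrier is the logarithm of the distance. All arguments stay within the natural numbers. Strict
-- inequalities between integers replace the choice of an extremal point: a bound on the excess, or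
-- a lower bound still to be reached, moves by one in each round of an induction. Logarithms appear
-- only exponentiated, and profiles are compared after multiplying by their upper bounds.

open import Defs
open import Data.Bool using (Bool; true; false; _∧_; _∨_; if_then_else_)
open import Data.Fin using (Fin; toℕ; fromℕ<) renaming (zero to fzero; suc to fsuc)
open import Data.Fin.Properties using (any?; toℕ-injective; toℕ<n; toℕ-fromℕ<) renaming (_≟_ to _≟ᶠ_)
open import Data.Nat
open import Data.Nat.DivMod using (_/_; m≡m%n+[m/n]*n; m%n<n; m/n*n≤m; /-monoˡ-≤)
open import Data.Nat.Logarithm using (⌊log₂_⌋; ⌊log₂⌋-mono-≤; ⌊log₂[2^n]⌋≡n)
open import Data.Nat.Properties
open import Data.Nat.Tactic.RingSolver using (solve-∀)
open import Data.Product using (Σ; ∃; ∃₂; _×_; _,_; proj₁; proj₂)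
open import Data.Sum using (_⊎_; inj₁; inj₂)
open import Data.Vec using (Vec; lookup; tabulate)
open import Data.Vec.Properties using (lookup∘tabulate; lookup-replicate; tabulate∘lookup; tabulate-cong)
open import Relation.Binary.PropositionalEquality
open import Relation.Nullary using (¬_; Dec; yes; no; contradiction)
open import Relation.Nullary.Decidable using (_×-dec_; ⌊_⌋)

-- A linear combination of known (in)equalities, with slack c; the remaining identity is left to the ring solver.
≤-by : ∀ {a b l r} c → l ≤ r → a + r + c ≡ b + l → a ≤ b
≤-by {a} {b} {l} {r} c l≤r eq = +-cancelʳ-≤ r a b (begin
  a + r      ≤⟨ m≤m+n (a + r) c ⟩
  a + r + c  ≡⟨ eq ⟩
  b + l      ≤⟨ +-monoʳ-≤ b l≤r ⟩
  b + r      ∎)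
  where open ≤-Reasoning

≡-by : ∀ {a b l r} → l ≡ r → a + r ≡ b + l → a ≡ b
≡-by {a} {b} {l} {r} l≡r eq = +-cancelʳ-≡ r a b (trans eq (cong (b +_) l≡r))

+0-intro : ∀ {a b} → a ≤ b → a + 0 ≤ b
+0-intro {a} {b} = subst (_≤ b) (sym (+-identityʳ a))

+0-elim : ∀ {a b} → a + 0 ≤ b → a ≤ b
+0-elim {a} {b} = subst (_≤ b) (+-identityʳ a)

-- Fields on the closed grid {0,…,n+1}² and the maximum principle

Field : Set
Field = ℕ → ℕ → ℕ

nb : Field → ℕ → ℕ → ℕ
nb f i j = (f i (suc j) + f (suc (suc i)) (suc j)) + (f (suc i) j + f (suc i) (suc (suc j)))

module _ (f : Field) (i j : ℕ) where

  private
    W E S N : ℕ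
    W = f i (suc j)
    E = f (suc (suc i)) (suc j)
    S = f (suc i) j
    N = f (suc i) (suc (suc j))

  west≤nb : W ≤ nb f i j
  west≤nb = ≤-trans (m≤m+n W E) (m≤m+n (W + E) (S + N))

  east≤nb : E ≤ nb f i j
  east≤nb = ≤-trans (m≤n+m E W) (m≤m+n (W + E) (S + N))

  south≤nb : S ≤ nb f i j
  south≤nb = ≤-trans (m≤m+n S N) (m≤n+m (S + N) (W + E))

  north≤nb : N ≤ nb f i j
  north≤nb = ≤-trans (m≤n+m N S) (m≤n+m (S + N) (W + E))

data StrictAt (A B : Field) : ℕ → ℕ → Set where
  interior : ∀ {i j} → nb A i j < 4 * A (suc i) (suc j) → 4 * B (suc i) (suc j) ≤ nb B i j →
             StrictAt A B (suc i) (suc j)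

-- If B exceeds A by at most M + 1 everywhere, then averaging over the neighbours and the strictness
-- at A give B < A + M + 1. As the values are integers, the uniform excess drops by one in each
-- round, and no point of maximal excess has to be found.
maximum-principle : ∀ (A B : Field) M → (∀ x y → B x y ≤ A x y + M) →
  (∀ x y → B x y ≤ A x y ⊎ StrictAt A B x y) → ∀ x y → B x y ≤ A x y
maximum-principle A B zero bound local x y = subst (B x y ≤_) (+-identityʳ _) (bound x y)
maximum-principle A B (suc M) bound local = maximum-principle A B M improved local
  where
  ring : ∀ a b c d m → (a + suc m + (b + suc m)) + (c + suc m + (d + suc m)) ≡ (a + b) + (c + d) + 4 * suc m
  ring = solve-∀
  improved : ∀ x y → B x y ≤ A x y + M
  improved x y with local x y
  ... | inj₁ B≤A = ≤-trans B≤A (m≤m+n _ M)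
  ... | inj₂ (interior {i} {j} nbA< ≤nbB) =
    s≤s⁻¹ (subst (B (suc i) (suc j) <_) (+-suc _ M) (*-cancelˡ-< 4 _ _ (begin-strict
      4 * B (suc i) (suc j)          ≤⟨ ≤nbB ⟩
      nb B i j                       ≤⟨ +-mono-≤ (+-mono-≤ (bound _ _) (bound _ _))
          (+-mono-≤ (bound _ _) (bound _ _)) ⟩
      _                              ≡⟨ ring (A i (suc j)) (A (suc (suc i)) (suc j)) (A (suc i) j)
          (A (suc i) (suc (suc j))) M ⟩
      nb A i j + 4 * suc M           <⟨ +-monoˡ-< (4 * suc M) nbA< ⟩
      4 * A (suc i) (suc j) + 4 * suc M ≡⟨ *-distribˡ-+ 4 (A (suc i) (suc j)) (suc M) ⟨
      4 * (A (suc i) (suc j) + suc M) ∎)))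
    where open ≤-Reasoning

-- Harnack inequality with logarithmic loss

sqdist : ℕ → ℕ → ℕ
sqdist x y = ∣ x - y ∣ * ∣ x - y ∣

-- For d = i + 1 - z, the sum and the product of (d - 1)² and (d + 1)² are polynomials in d².
-- Through this lemma and the next, the computation with poles needs only d² and never the sign of
-- d.
sqdist-nbrs-+ : ∀ i z → sqdist i z + sqdist (suc (suc i)) z ≡ 2 * sqdist (suc i) z + 2
sqdist-nbrs-+ zero zero = refl
sqdist-nbrs-+ (suc i) zero = ring i
  where
  ring : ∀ i → (1 + i) * (1 + i) + (3 + i) * (3 + i) ≡ 2 * ((2 + i) * (2 + i)) + 2
  ring = solve-∀
sqdist-nbrs-+ zero (suc zero) = refl
sqdist-nbrs-+ zero (suc (suc z)) = ring z
  where
  ring : ∀ i → (2 + i) * (2 + i) + i * i ≡ 2 * ((1 + i) * (1 + i)) + 2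
  ring = solve-∀
sqdist-nbrs-+ (suc i) (suc z) = sqdist-nbrs-+ i z

sqdist-nbrs-* : ∀ i z → sqdist i z * sqdist (suc (suc i)) z + 2 * sqdist (suc i) z ≡
    sqdist (suc i) z * sqdist (suc i) z + 1
sqdist-nbrs-* zero zero = refl
sqdist-nbrs-* (suc i) zero = ring i
  where
  ring : ∀ i → (1 + i) * (1 + i) * ((3 + i) * (3 + i)) + 2 * ((2 + i) * (2 + i)) ≡
      (2 + i) * (2 + i) * ((2 + i) * (2 + i)) + 1
  ring = solve-∀
sqdist-nbrs-* zero (suc zero) = refl
sqdist-nbrs-* zero (suc (suc z)) = ring z
  where
  ring : ∀ i → (2 + i) * (2 + i) * (i * i) + 2 * ((1 + i) * (1 + i)) ≡ (1 + i) * (1 + i) * ((1 + i) * (1 + i)) + 1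
  ring = solve-∀
sqdist-nbrs-* (suc i) (suc z) = sqdist-nbrs-* i z

-- 4(s − 3/4) for s = |z|². With this shift the product over the four neighbours of z is less than the
-- fourth power (pole-superharmonic), that is, −log pole is strictly subharmonic.
pole : ℕ → ℕ
pole s = 4 * s ∸ 3

pole+3 : ∀ {s} → 1 ≤ s → pole s + 3 ≡ 4 * s
pole+3 {s} 1≤s = m∸n+n≡m (≤-trans (s≤s (s≤s (s≤s z≤n))) (*-monoʳ-≤ 4 1≤s))

pole-pair : ∀ X₀ X₂ X Y Q₁ Q₂ → Q₁ + 3 ≡ 4 * (X₀ + Y) → Q₂ + 3 ≡ 4 * (X₂ + Y) →
  X₀ + X₂ ≡ 2 * X + 2 → X₀ * X₂ + 2 * X ≡ X * X + 1 →
  Q₁ * Q₂ + 56 * X ≡ 16 * ((X + Y) * (X + Y)) + 8 * Y + 1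
pole-pair X₀ X₂ X Y Q₁ Q₂ e₁ e₂ e₊ e* = ≡-by combination (ring₂ X₀ X₂ X Y (Q₁ * Q₂))
  where
  ring₁ : ∀ q r → q * r + (3 * (q + 3) + 3 * (r + 3)) ≡ (q + 3) * (r + 3) + 9
  ring₁ = solve-∀
  product : Q₁ * Q₂ + (3 * (4 * (X₀ + Y)) + 3 * (4 * (X₂ + Y))) ≡ 4 * (X₀ + Y) * (4 * (X₂ + Y)) + 9
  product = subst₂ (λ a b → Q₁ * Q₂ + (3 * a + 3 * b) ≡ a * b + 9) e₁ e₂ (ring₁ Q₁ Q₂)
  combination : Q₁ * Q₂ + (3 * (4 * (X₀ + Y)) + 3 * (4 * (X₂ + Y))) + 16 * (X₀ * X₂ + 2 * X) + 16 * Y *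
      (X₀ + X₂) + 12 * (2 * X + 2)
    ≡ 4 * (X₀ + Y) * (4 * (X₂ + Y)) + 9 + 16 * (X * X + 1) + 16 * Y * (2 * X + 2) + 12 * (X₀ + X₂)
  combination = cong₂ _+_ (cong₂ _+_ (cong₂ _+_ product (cong (16 *_) e*)) (cong (16 * Y *_) e₊))
      (cong (12 *_) (sym e₊))
  ring₂ : ∀ X₀ X₂ X Y P → P + 56 * X + (4 * (X₀ + Y) * (4 * (X₂ + Y)) + 9 + 16 * (X * X + 1) + 16 * Y *
      (2 * X + 2) + 12 * (X₀ + X₂))
    ≡ 16 * ((X + Y) * (X + Y)) + 8 * Y + 1 + (P + (3 * (4 * (X₀ + Y)) + 3 * (4 * (X₂ + Y))) + 16 *
        (X₀ * X₂ + 2 * X) + 16 * Y * (X₀ + X₂) + 12 * (2 * X + 2))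
  ring₂ = solve-∀

-- With a shift t in place of 3 in `pole`, the sum of the two products of opposite neighbours is 2Q²
-- + 32 - 16t. The least integer t that makes this smaller than 2Q² is 3, and it also gives `pole`
-- the value 1 at distance 1. The arithmetic-geometric mean inequality then bounds the product of
-- all four neighbours.
pole-nbrs : ∀ X Y Q P₁ P₂ → Q + 3 ≡ 4 * (X + Y) →
  P₁ + 56 * X ≡ 16 * ((X + Y) * (X + Y)) + 8 * Y + 1 →
  P₂ + 56 * Y ≡ 16 * ((Y + X) * (Y + X)) + 8 * X + 1 →
  P₁ + P₂ + 16 ≡ 2 * (Q * Q)
pole-nbrs X Y Q P₁ P₂ e e₁ e₂ = ≡-by combination (ring₂ X Y P₁ P₂ (Q * Q))
  where
  ring₁ : ∀ q → q * q + 6 * (q + 3) ≡ (q + 3) * (q + 3) + 9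
  ring₁ = solve-∀
  square : Q * Q + 6 * (4 * (X + Y)) ≡ 4 * (X + Y) * (4 * (X + Y)) + 9
  square = subst (λ a → Q * Q + 6 * a ≡ a * a + 9) e (ring₁ Q)
  combination : (P₁ + 56 * X) + (P₂ + 56 * Y) + 2 * (4 * (X + Y) * (4 * (X + Y)) + 9)
    ≡ (16 * ((X + Y) * (X + Y)) + 8 * Y + 1) + (16 * ((Y + X) * (Y + X)) + 8 * X + 1) + 2 *
        (Q * Q + 6 * (4 * (X + Y)))
  combination = cong₂ _+_ (cong₂ _+_ e₁ e₂) (cong (2 *_) (sym square))
  ring₂ : ∀ X Y P₁ P₂ S → P₁ + P₂ + 16 + ((16 * ((X + Y) * (X + Y)) + 8 * Y + 1) +
      (16 * ((Y + X) * (Y + X)) + 8 * X + 1) + 2 * (S + 6 * (4 * (X + Y))))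
    ≡ 2 * S + ((P₁ + 56 * X) + (P₂ + 56 * Y) + 2 * (4 * (X + Y) * (4 * (X + Y)) + 9))
  ring₂ = solve-∀

am-gm : ∀ p q → 4 * (p * q) ≤ (p + q) * (p + q)
am-gm p q with ≤-total p q
... | inj₁ p≤q = subst (λ q → 4 * (p * q) ≤ (p + q) * (p + q)) (m+[n∸m]≡n p≤q)
    (≤-by ((q ∸ p) * (q ∸ p)) ≤-refl (ring p (q ∸ p)))
  where
  ring : ∀ p d → 4 * (p * (p + d)) + 0 + d * d ≡ (p + (p + d)) * (p + (p + d)) + 0
  ring = solve-∀
... | inj₂ q≤p = subst (λ p → 4 * (p * q) ≤ (p + q) * (p + q)) (m+[n∸m]≡n q≤p)
    (≤-by ((p ∸ q) * (p ∸ q)) ≤-refl (ring q (p ∸ q)))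
  where
  ring : ∀ q d → 4 * ((q + d) * q) + 0 + d * d ≡ ((q + d) + q) * ((q + d) + q) + 0
  ring = solve-∀

pole-product< : ∀ P₁ P₂ Q → P₁ + P₂ + 16 ≡ 2 * (Q * Q) → P₁ * P₂ < Q * Q * (Q * Q)
pole-product< P₁ P₂ Q eq = *-cancelˡ-< 4 _ _ (begin-strict
  4 * (P₁ * P₂)             ≤⟨ am-gm P₁ P₂ ⟩
  (P₁ + P₂) * (P₁ + P₂)     <⟨ *-mono-< lt lt ⟩
  2 * (Q * Q) * (2 * (Q * Q)) ≡⟨ ring (Q * Q) ⟩
  4 * (Q * Q * (Q * Q)) ∎)
  where
  open ≤-Reasoning
  ring : ∀ s → 2 * s * (2 * s) ≡ 4 * (s * s)
  ring = solve-∀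
  lt : P₁ + P₂ < 2 * (Q * Q)
  lt = subst (P₁ + P₂ <_) eq (m<m+n (P₁ + P₂) (s≤s z≤n))

*-^ : ∀ m n o → (m * n) ^ o ≡ m ^ o * n ^ o
*-^ m n zero = refl
*-^ m n (suc o) = trans (cong (m * n *_) (*-^ m n o)) ([m*n]*[o*p]≡[m*o]*[n*p] m n (m ^ o) (n ^ o))

pole-mono : ∀ {s t} → s ≤ t → pole s ≤ pole t
pole-mono s≤t = ∸-monoˡ-≤ 3 (*-monoʳ-≤ 4 s≤t)

Superharmonic : ℕ → Field → Set
Superharmonic n v = ∀ i j → i < n → j < n → nb v i j ≤ 4 * v (suc i) (suc j)

dist² : ℕ → ℕ → Field
dist² x₀ y₀ x y = sqdist x x₀ + sqdist y y₀

sqdist-off-centre : ∀ i z → 2 ≤ sqdist (suc i) z → 1 ≤ sqdist i z × 1 ≤ sqdist (suc (suc i)) z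
sqdist-off-centre zero zero (s≤s ())
sqdist-off-centre (suc i) zero _ = s≤s z≤n , s≤s z≤n
sqdist-off-centre zero (suc zero) ()
sqdist-off-centre zero (suc (suc zero)) (s≤s ())
sqdist-off-centre zero (suc (suc (suc z))) _ = s≤s z≤n , s≤s z≤n
sqdist-off-centre (suc i) (suc z) far = sqdist-off-centre i z far

-- Squared distance at least 2 excludes the centre and the vertices adjacent to it, so the truncated
-- subtraction in `pole` is exact at every neighbour.
nbrs-off-centre : ∀ i z Y → 2 ≤ sqdist (suc i) z + Y → 1 ≤ sqdist i z + Y × 1 ≤ sqdist (suc (suc i)) z + Y
nbrs-off-centre i z (suc Y) far = m≤n⇒m≤o+n _ (s≤s z≤n) , m≤n⇒m≤o+n _ (s≤s z≤n)
nbrs-off-centre i z zero far with l , r ← sqdist-off-centre i z (subst (2 ≤_) (+-identityʳ _) far) =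
  m≤n⇒m≤n+o zero l , m≤n⇒m≤n+o zero r

sqdist-near : ∀ x z → sqdist x z ≤ 1 → x ≡ z ⊎ (x ≡ suc z ⊎ z ≡ suc x)
sqdist-near zero zero _ = inj₁ refl
sqdist-near (suc zero) zero _ = inj₂ (inj₁ refl)
sqdist-near (suc (suc x)) zero (s≤s ())
sqdist-near zero (suc zero) _ = inj₂ (inj₂ refl)
sqdist-near zero (suc (suc z)) (s≤s ())
sqdist-near (suc x) (suc z) near with sqdist-near x z near
... | inj₁ eq = inj₁ (cong suc eq)
... | inj₂ (inj₁ eq) = inj₂ (inj₁ (cong suc eq))
... | inj₂ (inj₂ eq) = inj₂ (inj₂ (cong suc eq))

data InGrid (n : ℕ) : ℕ → Set where
  inside : ∀ {i} → i < n → InGrid n (suc i)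

module _ {n z T : ℕ} (T≤z : T ≤ z) (z+T≤N : z + T ≤ suc n) where

  sqdist-boundary : ∀ {x} → x ≤ suc n → InGrid n x ⊎ T * T ≤ sqdist x z
  sqdist-boundary {zero} _ = inj₂ (*-mono-≤ T≤z T≤z)
  sqdist-boundary {suc i} (s≤s i≤n) with m≤n⇒m<n∨m≡n i≤n
  ... | inj₁ i<n = inj₁ (inside i<n)
  ... | inj₂ refl = inj₂ (*-mono-≤ T≤ T≤)
    where
    T≤ : T ≤ ∣ suc n - z ∣
    T≤ = ≤-trans (m+n≤o⇒m≤o∸n T (subst (_≤ suc n) (+-comm z T) z+T≤N)) (m∸n≤∣m-n∣ (suc n) z)

module _ (n : ℕ) (v : Field) (superharmonic : Superharmonic n v) (x₀ y₀ T : ℕ)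
         (T≤x₀ : T ≤ x₀) (T≤y₀ : T ≤ y₀) (x₀+T≤N : x₀ + T ≤ suc n) (y₀+T≤N : y₀ + T ≤ suc n) where

  private
    s Q : Field
    s = dist² x₀ y₀
    Q x y = pole (s x y)

  pole-superharmonic : ∀ i j → 2 ≤ s (suc i) (suc j) →
    Q i (suc j) * Q (suc (suc i)) (suc j) * (Q (suc i) j * Q (suc i) (suc (suc j))) <
    Q (suc i) (suc j) * Q (suc i) (suc j) * (Q (suc i) (suc j) * Q (suc i) (suc j))
  pole-superharmonic i j far =
    pole-product< (Q i (suc j) * Q (suc (suc i)) (suc j)) (Q (suc i) j * Q (suc i) (suc (suc j))) (Q (suc i) (suc j))
      (pole-nbrs X Y (Q (suc i) (suc j)) (Q i (suc j) * Q (suc (suc i)) (suc j))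
          (Q (suc i) j * Q (suc i) (suc (suc j))) (pole+3 (≤-trans (s≤s z≤n) far))
        (pole-pair X₀ X₂ X Y (Q i (suc j)) (Q (suc (suc i)) (suc j)) (pole+3 (proj₁ horizontal))
            (pole+3 (proj₂ horizontal))
          (sqdist-nbrs-+ i x₀) (sqdist-nbrs-* i x₀))
        (pole-pair Y₀ Y₂ Y X (Q (suc i) j) (Q (suc i) (suc (suc j)))
            (trans (pole+3 (subst (1 ≤_) (+-comm Y₀ X) (proj₁ vertical))) (cong (4 *_) (+-comm X Y₀)))
          (trans (pole+3 (subst (1 ≤_) (+-comm Y₂ X) (proj₂ vertical))) (cong (4 *_) (+-comm X Y₂)))
          (sqdist-nbrs-+ j y₀) (sqdist-nbrs-* j y₀)))
    where
    X = sqdist (suc i) x₀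
    X₀ = sqdist i x₀
    X₂ = sqdist (suc (suc i)) x₀
    Y = sqdist (suc j) y₀
    Y₀ = sqdist j y₀
    Y₂ = sqdist (suc (suc j)) y₀
    horizontal : 1 ≤ X₀ + Y × 1 ≤ X₂ + Y
    horizontal = nbrs-off-centre i x₀ Y far
    vertical : 1 ≤ Y₀ + X × 1 ≤ Y₂ + X
    vertical = nbrs-off-centre j y₀ X (subst (2 ≤_) (+-comm X Y) far)

  module _ (λ′ : ℕ) {{_ : NonZero λ′}} (Λ : ℕ) (Λ-large : pole (T * T) ^ λ′ ≤ 2 ^ Λ)
           (near-pole : ∀ {x y} → InGrid n x → InGrid n y → s x y ≡ 1 → Λ ≤ v x y) where

    private
      -- A lower bound R ^ λ′ for E, with R = pole (T * T), says v ≥ λ′ log₂(R / Q). This barrier is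
      -- at most Λ next to the centre, where Q = 1, and at most 0 from distance T on.
      E : Field
      E x y = 2 ^ v x y * Q x y ^ λ′

    E-nbrs< : ∀ i j → i < n → j < n → 2 ≤ s (suc i) (suc j) →
      E i (suc j) * E (suc (suc i)) (suc j) * (E (suc i) j * E (suc i) (suc (suc j))) <
      E (suc i) (suc j) * E (suc i) (suc j) * (E (suc i) (suc j) * E (suc i) (suc j))
    E-nbrs< i j i<n j<n far = begin-strict
      E i (suc j) * E (suc (suc i)) (suc j) * (E (suc i) j * E (suc i) (suc (suc j)))
        ≡⟨ product (v i (suc j)) (v (suc (suc i)) (suc j)) (v (suc i) j) (v (suc i) (suc (suc j)))
                   (Q i (suc j)) (Q (suc (suc i)) (suc j)) (Q (suc i) j) (Q (suc i) (suc (suc j))) ⟩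
      2 ^ nb v i j * (Q i (suc j) * Q (suc (suc i)) (suc j) * (Q (suc i) j * Q (suc i) (suc (suc j)))) ^ λ′
        <⟨ *-monoʳ-< (2 ^ nb v i j) {{m^n≢0 2 (nb v i j)}} (^-monoˡ-< λ′ (pole-superharmonic i j far)) ⟩
      2 ^ nb v i j * (q * q * (q * q)) ^ λ′
        ≤⟨ *-monoˡ-≤ ((q * q * (q * q)) ^ λ′)
            (^-monoʳ-≤ 2 (≤-trans (superharmonic i j i<n j<n) (≤-reflexive (four (v (suc i) (suc j)))))) ⟩
      2 ^ (c + c + (c + c)) * (q * q * (q * q)) ^ λ′
        ≡⟨ product c c c c q q q q ⟨
      E (suc i) (suc j) * E (suc i) (suc j) * (E (suc i) (suc j) * E (suc i) (suc j)) ∎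
      where
      open ≤-Reasoning
      q = Q (suc i) (suc j)
      c = v (suc i) (suc j)
      four : ∀ a → 4 * a ≡ a + a + (a + a)
      four = solve-∀
      pair : ∀ a b p r → 2 ^ a * p ^ λ′ * (2 ^ b * r ^ λ′) ≡ 2 ^ (a + b) * (p * r) ^ λ′
      pair a b p r = trans ([m*n]*[o*p]≡[m*o]*[n*p] (2 ^ a) (p ^ λ′) (2 ^ b) (r ^ λ′))
        (sym (cong₂ _*_ (^-distribˡ-+-* 2 a b) (*-^ p r λ′)))
      product : ∀ a b c d p r t w →
        2 ^ a * p ^ λ′ * (2 ^ b * r ^ λ′) * (2 ^ c * t ^ λ′ * (2 ^ d * w ^ λ′)) ≡
        2 ^ (a + b + (c + d)) * (p * r * (t * w)) ^ λ′
      product a b c d p r t w = trans (cong₂ _*_ (pair a b p r) (pair c d t w)) (pair (a + b) (c + d) (p * r) (t * w))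

    E-far : ∀ {x y} → T * T ≤ s x y → pole (T * T) ^ λ′ ≤ E x y
    E-far {x} {y} far = ≤-trans (^-monoˡ-≤ λ′ (pole-mono far)) (m≤n*m _ (2 ^ v x y) {{m^n≢0 2 (v x y)}})

    -- The maximum principle for v + λ′ log₂ Q, exponentiated. As E is integer-valued and E(z)⁴ exceeds the
    -- product over the neighbours, a lower bound m for E improves to m + 1 until the boundary value is reached.
    harnack-power : ∀ m → m ≤ pole (T * T) ^ λ′ → ∀ x y → x ≤ suc n → y ≤ suc n → 1 ≤ s x y → m ≤ E x y
    harnack-power zero _ x y x≤N y≤N off = z≤n
    harnack-power (suc m) m<K x y x≤N y≤N off
      with sqdist-boundary T≤x₀ x₀+T≤N x≤N | sqdist-boundary T≤y₀ y₀+T≤N y≤N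
    ... | inj₂ far | _ = ≤-trans m<K (E-far (≤-trans far (m≤m+n _ _)))
    ... | inj₁ _ | inj₂ far = ≤-trans m<K (E-far (≤-trans far (m≤n+m _ _)))
    ... | inj₁ (inside {i} i<n) | inj₁ (inside {j} j<n) with m≤n⇒m<n∨m≡n off
    ...   | inj₂ 1≡s = begin
      suc m                 ≤⟨ m<K ⟩
      pole (T * T) ^ λ′     ≤⟨ Λ-large ⟩
      2 ^ Λ                 ≤⟨ ^-monoʳ-≤ 2 (near-pole (inside i<n) (inside j<n) (sym 1≡s)) ⟩
      2 ^ v (suc i) (suc j) ≡⟨ *-identityʳ _ ⟨
      2 ^ v (suc i) (suc j) * 1 ≡⟨ cong (2 ^ v (suc i) (suc j) *_)
          (trans (cong (λ s → pole s ^ λ′) (sym 1≡s)) (^-zeroˡ λ′)) ⟨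
      E (suc i) (suc j) ∎
      where open ≤-Reasoning
    ...   | inj₁ far = ≰⇒> λ E≤m → <⇒≱ (E-nbrs< i j i<n j<n far)
            (≤-trans (*-mono-≤ (*-mono-≤ E≤m E≤m) (*-mono-≤ E≤m E≤m))
              (*-mono-≤ (*-mono-≤ (IH i (suc j) (m≤n⇒m≤1+n (<⇒≤ i<n)) y≤N (proj₁ horizontal))
                                  (IH (suc (suc i)) (suc j) (s≤s i<n) y≤N (proj₂ horizontal)))
                        (*-mono-≤ (IH (suc i) j x≤N (m≤n⇒m≤1+n (<⇒≤ j<n))
                            (subst (1 ≤_) (+-comm _ X) (proj₁ vertical)))
                                  (IH (suc i) (suc (suc j)) x≤N (s≤s j<n)
                                      (subst (1 ≤_) (+-comm _ X) (proj₂ vertical))))))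
      where
      IH = harnack-power m (<⇒≤ m<K)
      X = sqdist (suc i) x₀
      Y = sqdist (suc j) y₀
      horizontal = nbrs-off-centre i x₀ Y far
      vertical = nbrs-off-centre j y₀ X (subst (2 ≤_) (+-comm X Y) far)

  -- The comparison starts at distance 1 because the barrier is infinite at the centre. Passing
  -- there costs a factor 4: the centre is one of the four neighbours in the superharmonicity of the
  -- nonnegative v at (x, y).
  near-pole : ∀ {Λ} → 4 * Λ ≤ v x₀ y₀ → ∀ {x y} → InGrid n x → InGrid n y → s x y ≡ 1 → Λ ≤ v x y
  near-pole {Λ} 4Λ≤ {x} {y} ix iy s≡1 = *-cancelˡ-≤ 4 (≤-trans 4Λ≤ (adjacent ix iy
      (sqdist-near x x₀ (≤-trans (m≤m+n _ _) (≤-reflexive s≡1)))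
      (sqdist-near y y₀ (≤-trans (m≤n+m _ (sqdist x x₀)) (≤-reflexive s≡1))) s≡1))
    where
    adjacent : ∀ {x y} → InGrid n x → InGrid n y → x ≡ x₀ ⊎ (x ≡ suc x₀ ⊎ x₀ ≡ suc x) → y ≡ y₀ ⊎
        (y ≡ suc y₀ ⊎ y₀ ≡ suc y) →
      s x y ≡ 1 → v x₀ y₀ ≤ 4 * v x y
    adjacent (inside {i} i<n) (inside {j} j<n) (inj₁ refl) (inj₂ (inj₁ refl)) _ =
      ≤-trans (south≤nb v i j) (superharmonic i j i<n j<n)
    adjacent (inside {i} i<n) (inside {j} j<n) (inj₁ refl) (inj₂ (inj₂ refl)) _ =
      ≤-trans (north≤nb v i j) (superharmonic i j i<n j<n)
    adjacent (inside {i} i<n) (inside {j} j<n) (inj₂ (inj₁ refl)) (inj₁ refl) _ =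
      ≤-trans (west≤nb v i j) (superharmonic i j i<n j<n)
    adjacent (inside {i} i<n) (inside {j} j<n) (inj₂ (inj₂ refl)) (inj₁ refl) _ =
      ≤-trans (east≤nb v i j) (superharmonic i j i<n j<n)
    adjacent {x} {y} _ _ (inj₁ refl) (inj₁ refl) s≡1 =
      contradiction (trans (sym (cong₂ (λ a b → a * a + b * b) (∣n-n∣≡0 x) (∣n-n∣≡0 y))) s≡1) λ ()
    adjacent {x} {y} _ _ (inj₂ ex) (inj₂ ey) s≡1 = contradiction s≡1 (≢1 ex ey)
      where
      one : ∀ {a b} → a ≡ suc b ⊎ b ≡ suc a → sqdist a b ≡ 1
      one {b = b} (inj₁ refl) = cong (λ d → d * d)
          (trans (∣-∣-comm (suc b) b) (trans (cong ∣ b -_∣ (+-comm 1 b)) (∣m-m+n∣≡n b 1)))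
      one {a} (inj₂ refl) = cong (λ d → d * d) (trans (cong ∣ a -_∣ (+-comm 1 a)) (∣m-m+n∣≡n a 1))
      ≢1 : ∀ {a b c d} → a ≡ suc b ⊎ b ≡ suc a → c ≡ suc d ⊎ d ≡ suc c → sqdist a b + sqdist c d ≢ 1
      ≢1 ex ey rewrite one ex | one ey = λ ()

  -- The barrier falls from at most (ℓ + 2)λ′ next to the centre to at least λ′ log₂(4/3) at
  -- distance T√3/2. The quotient of these two values, times the factor 4 of `near-pole`, is the
  -- loss.
  harnack : ∀ ℓ m → T * T ≤ 2 ^ ℓ → 2 ≤ T → (12 * ℓ + 24) * m ≤ v x₀ y₀ →
    ∀ x y → x ≤ suc n → y ≤ suc n → 4 * s x y ≤ 3 * (T * T) → m ≤ v x y
  harnack ℓ zero _ _ _ x y _ _ _ = z≤n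
  harnack ℓ m@(suc _) T²≤ 2≤T large x y x≤N y≤N close with s x y in s≡
  ... | zero = subst₂ (λ a b → m ≤ v a b)
      (sym (coincide x x₀ (m+n≡0⇒m≡0 _ s≡))) (sym (coincide y y₀ (m+n≡0⇒n≡0 (sqdist x x₀) s≡)))
      (≤-trans (m≤n*m m (12 * ℓ + 24) {{>-nonZero (m≤n⇒m≤o+n (12 * ℓ) (s≤s z≤n))}}) large)
    where
    coincide : ∀ a b → sqdist a b ≡ 0 → a ≡ b
    coincide a b eq with m*n≡0⇒m≡0∨n≡0 ∣ a - b ∣ eq
    ... | inj₁ d≡0 = ∣m-n∣≡0⇒m≡n d≡0
    ... | inj₂ d≡0 = ∣m-n∣≡0⇒m≡n d≡0
  ... | r@(suc _) = 2^-cancel (*-cancelʳ-≤ _ _ (27 ^ m) {{m^n≢0 27 m}} (begin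
      2 ^ m * 27 ^ m           ≡⟨ *-^ 2 27 m ⟨
      54 ^ m                   ≤⟨ ^-monoˡ-≤ m (m≤m+n 54 10) ⟩
      64 ^ m                   ≡⟨ ^-*-assoc 4 3 m ⟩
      4 ^ j                    ≤⟨ *-cancelʳ-≤ _ _ (R ^ j) {{m^n≢0 R j {{>-nonZero R>0}}}} scaled ⟩
      2 ^ v x y * 3 ^ j        ≡⟨ cong (2 ^ v x y *_) (^-*-assoc 3 3 m) ⟨
      2 ^ v x y * 27 ^ m       ∎))
    where
    open ≤-Reasoning
    j R Λ : ℕ
    -- The exponent 3m is chosen because (4/3)³ = 64/27 ≥ 2, so that a ratio R / Q ≥ 4/3 yields 2 ^
    -- m. Then Λ is forced by R ≤ 4 · 2 ^ ℓ, and 4Λ = (12ℓ + 24)m.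
    j = 3 * m
    R = pole (T * T)
    Λ = (ℓ + 2) * j
    1≤T² : 1 ≤ T * T
    1≤T² = *-mono-≤ (<⇒≤ 2≤T) (<⇒≤ 2≤T)
    R>0 : 0 < R
    R>0 = pole-mono {1} {T * T} 1≤T²
    2^-cancel : ∀ {a b} → 2 ^ a ≤ 2 ^ b → a ≤ b
    2^-cancel 2^≤ = ≮⇒≥ λ b<a → <⇒≱ (^-monoʳ-< 2 ≤-refl b<a) 2^≤
    ring₁ : ∀ ℓ m → 4 * ((ℓ + 2) * (3 * m)) ≡ (12 * ℓ + 24) * m
    ring₁ = solve-∀
    R-large : R ^ j ≤ 2 ^ Λ
    R-large = begin
      R ^ j               ≤⟨ ^-monoˡ-≤ j (≤-trans (m∸n≤m _ 3)
          (≤-trans (*-monoʳ-≤ 4 T²≤) (≤-reflexive (trans (*-comm 4 (2 ^ ℓ)) (sym (^-distribˡ-+-* 2 ℓ 2)))))) ⟩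
      (2 ^ (ℓ + 2)) ^ j   ≡⟨ ^-*-assoc 2 (ℓ + 2) j ⟩
      2 ^ Λ               ∎
    ratio : 4 * pole r ≤ 3 * R
    ratio = ≤-by 3 (*-monoʳ-≤ 4 close)
      (combine r (T * T) (pole r) R (pole+3 {r} (s≤s z≤n)) (pole+3 1≤T²))
      where
      combine : ∀ s t q r → q + 3 ≡ 4 * s → r + 3 ≡ 4 * t → 4 * q + 4 * (3 * t) + 3 ≡ 3 * r + 4 * (4 * s)
      combine s t q r eq er = ≡-by (cong₂ _+_ (cong (4 *_) eq) (cong (3 *_) (sym er))) (ring s t q r)
        where
        ring : ∀ s t q r → 4 * q + 4 * (3 * t) + 3 + (4 * (4 * s) + 3 * (r + 3)) ≡
            3 * r + 4 * (4 * s) + (4 * (q + 3) + 3 * (4 * t))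
        ring = solve-∀
    lower : R ^ j ≤ 2 ^ v x y * pole r ^ j
    lower = subst (λ s → R ^ j ≤ 2 ^ v x y * pole s ^ j) s≡
      (harnack-power j Λ R-large (near-pole (subst (_≤ v x₀ y₀) (sym (ring₁ ℓ m)) large)) (R ^ j) ≤-refl x y x≤N y≤N
        (subst (1 ≤_) (sym s≡) (s≤s z≤n)))
    scaled : 4 ^ j * R ^ j ≤ 2 ^ v x y * 3 ^ j * R ^ j
    scaled = begin
      4 ^ j * R ^ j                       ≤⟨ *-monoʳ-≤ (4 ^ j) lower ⟩
      4 ^ j * (2 ^ v x y * pole r ^ j)    ≡⟨ ring₅ (4 ^ j) (2 ^ v x y) (pole r ^ j) ⟩
      2 ^ v x y * (4 ^ j * pole r ^ j)    ≡⟨ cong (2 ^ v x y *_) (*-^ 4 (pole r) j) ⟨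
      2 ^ v x y * (4 * pole r) ^ j        ≤⟨ *-monoʳ-≤ (2 ^ v x y) (^-monoˡ-≤ j ratio) ⟩
      2 ^ v x y * (3 * R) ^ j             ≡⟨ cong (2 ^ v x y *_) (*-^ 3 R j) ⟩
      2 ^ v x y * (3 ^ j * R ^ j)         ≡⟨ *-assoc (2 ^ v x y) (3 ^ j) (R ^ j) ⟨
      2 ^ v x y * 3 ^ j * R ^ j           ∎
      where
      ring₅ : ∀ a b c → a * (b * c) ≡ b * (a * c)
      ring₅ = solve-∀

-- A supersolution for the exit time

nb-mono : ∀ {f g : Field} → (∀ x y → f x y ≤ g x y) → ∀ i j → nb f i j ≤ nb g i j
nb-mono f≤g i j = +-mono-≤ (+-mono-≤ (f≤g _ _) (f≤g _ _)) (+-mono-≤ (f≤g _ _) (f≤g _ _))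

nb-cong : ∀ {f g : Field} → (∀ x y → f x y ≡ g x y) → ∀ i j → nb f i j ≡ nb g i j
nb-cong f≡g i j = cong₂ _+_ (cong₂ _+_ (f≡g _ _) (f≡g _ _)) (cong₂ _+_ (f≡g _ _) (f≡g _ _))

nb-+ : ∀ (f g : Field) i j → nb (λ x y → f x y + g x y) i j ≡ nb f i j + nb g i j
nb-+ f g i j = ring (f i (suc j)) (f (suc (suc i)) (suc j)) (f (suc i) j) (f (suc i) (suc (suc j)))
                    (g i (suc j)) (g (suc (suc i)) (suc j)) (g (suc i) j) (g (suc i) (suc (suc j)))
  where
  ring : ∀ a b c d a′ b′ c′ d′ → a + a′ + (b + b′) + (c + c′ + (d + d′)) ≡ a + b + (c + d) + (a′ + b′ + (c′ + d′))
  ring = solve-∀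

nb-* : ∀ k (f : Field) i j → nb (λ x y → k * f x y) i j ≡ k * nb f i j
nb-* k f i j = ring k (f i (suc j)) (f (suc (suc i)) (suc j)) (f (suc i) j) (f (suc i) (suc (suc j)))
  where
  ring : ∀ k a b c d → k * a + k * b + (k * c + k * d) ≡ k * (a + b + (c + d))
  ring = solve-∀

module _ (f g : Field) (i j : ℕ) where

  private
    f⊓g : Field
    f⊓g x y = f x y ⊓ g x y
    c₁ c₂ : ℕ
    c₁ = f (suc i) (suc j)
    c₂ = g (suc i) (suc j)

  ⊓-superharmonic : nb f i j ≤ 4 * c₁ → nb g i j ≤ 4 * c₂ → nb f⊓g i j ≤ 4 * (c₁ ⊓ c₂)
  ⊓-superharmonic f-sup g-sup with ≤-total c₁ c₂
  ... | inj₁ c₁≤c₂ rewrite m≤n⇒m⊓n≡m c₁≤c₂ = ≤-trans (nb-mono (λ x y → m⊓n≤m (f x y) (g x y)) i j) f-sup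
  ... | inj₂ c₂≤c₁ rewrite m≥n⇒m⊓n≡n c₂≤c₁ = ≤-trans (nb-mono (λ x y → m⊓n≤n (f x y) (g x y)) i j) g-sup

  ⊓-strict : nb g i j + 1 ≤ 4 * c₂ → c₂ ≤ c₁ → nb f⊓g i j + 1 ≤ 4 * (c₁ ⊓ c₂)
  ⊓-strict g-sup c₂≤c₁ rewrite m≥n⇒m⊓n≡n c₂≤c₁ = ≤-trans
      (+-monoˡ-≤ 1 (nb-mono (λ x y → m⊓n≤n (f x y) (g x y)) i j)) g-sup

gap² : ℕ → ℕ → ℕ
gap² M t = (M ∸ t) * (M ∸ t)

gap²-convex : ∀ M i → 2 * gap² M (suc i) ≤ gap² M i + gap² M (suc (suc i))
gap²-convex zero zero = z≤n
gap²-convex (suc zero) zero = z≤n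
gap²-convex (suc (suc M)) zero = ≤-by 2 ≤-refl (ring M)
  where
  ring : ∀ M → 2 * ((1 + M) * (1 + M)) + 0 + 2 ≡ (2 + M) * (2 + M) + M * M + 0
  ring = solve-∀
gap²-convex zero (suc i) = z≤n
gap²-convex (suc M) (suc i) = gap²-convex M i

-- The second difference of the parabola is 2, but at its vertex i + 1 = M the truncation leaves
-- only 1.
gap²-strictly-convex : ∀ M i → suc i ≤ M → 2 * gap² M (suc i) + 1 ≤ gap² M i + gap² M (suc (suc i))
gap²-strictly-convex (suc zero) zero _ = s≤s z≤n
gap²-strictly-convex (suc (suc M)) zero _ = ≤-by 1 ≤-refl (ring M)
  where
  ring : ∀ M → 2 * ((1 + M) * (1 + M)) + 1 + 0 + 1 ≡ (2 + M) * (2 + M) + M * M + 0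
  ring = solve-∀
gap²-strictly-convex (suc M) (suc i) (s≤s i<M) = gap²-strictly-convex M i i<M

-- The parabola 2Mt - t² up to its top at t = M and the constant M² from there on, by the truncation
-- in `gap²`. It is thus concave everywhere, and bumps of small scales remain superharmonic far from
-- the corner.
cap : ℕ → ℕ → ℕ
cap M t = M * M ∸ gap² M t

cap+gap² : ∀ M t → cap M t + gap² M t ≡ M * M
cap+gap² M t = m∸n+n≡m (*-mono-≤ (m∸n≤m M t) (m∸n≤m M t))

cap-from-gap² : ∀ M i c → 2 * gap² M (suc i) + c ≤ gap² M i + gap² M (suc (suc i)) →
  cap M i + cap M (suc (suc i)) + c ≤ 2 * cap M (suc i)
cap-from-gap² M i c convex = ≤-by 0 (+-mono-≤ convex (≤-reflexive (cong₂ _+_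
    (trans (cap+gap² M i) (sym (cap+gap² M (suc i)))) (trans (cap+gap² M (suc (suc i))) (sym (cap+gap² M (suc i)))))))
  (ring (cap M i) (cap M (suc i)) (cap M (suc (suc i))) (gap² M i) (gap² M (suc i)) (gap² M (suc (suc i))) c)
  where
  ring : ∀ a b d a′ b′ d′ c → a + d + c + (a′ + d′ + (b + b′ + (b + b′))) + 0 ≡
      2 * b + (2 * b′ + c + (a + a′ + (d + d′)))
  ring = solve-∀

cap-concave : ∀ M i → cap M i + cap M (suc (suc i)) ≤ 2 * cap M (suc i)
cap-concave M i = +0-elim (cap-from-gap² M i 0 (+0-intro (gap²-convex M i)))

cap-strictly-concave : ∀ M i → suc i ≤ M → cap M i + cap M (suc (suc i)) + 1 ≤ 2 * cap M (suc i)
cap-strictly-concave M i i<M = cap-from-gap² M i 1 (gap²-strictly-convex M i i<M)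

cap-linear : ∀ M t → cap M t ≤ 2 * (M * t)
cap-linear M t with ≤-total M t
... | inj₁ M≤t = ≤-trans (m∸n≤m (M * M) (gap² M t)) (≤-trans (*-monoʳ-≤ M M≤t) (m≤n*m (M * t) 2))
... | inj₂ t≤M = ≤-by (t * t) (≤-refl {gap² M t}) (trans (cong (λ s → s + t * t) (cap+gap² M t))
    (subst (λ M → M * M + t * t ≡ 2 * (M * t) + gap² M t) (m+[n∸m]≡n t≤M)
      (trans (ring t (M ∸ t)) (cong (λ e → 2 * ((t + (M ∸ t)) * t) + e * e) (sym (m+n∸m≡n t (M ∸ t)))))))
  where
  ring : ∀ t e → (t + e) * (t + e) + t * t ≡ 2 * ((t + e) * t) + e * e
  ring = solve-∀

-- Minima of superharmonic functions: 4xy is harmonic, cap M is strictly concave up to M, and cap M y ≤ 4xy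
-- as soon as M ≤ 2x. Hence bump M is strictly superharmonic where M/2 ≤ max x y ≤ M.
bump : ℕ → Field
bump M x y = (4 * (x * y) ⊓ cap M y) + (4 * (x * y) ⊓ cap M x)

xy-harmonic : ∀ i j → nb (λ x y → 4 * (x * y)) i j ≡ 4 * (4 * (suc i * suc j))
xy-harmonic = ring
  where
  ring : ∀ i j → 4 * (i * (1 + j)) + 4 * ((2 + i) * (1 + j)) + (4 * ((1 + i) * j) + 4 * ((1 + i) * (2 + j))) ≡
      4 * (4 * ((1 + i) * (1 + j)))
  ring = solve-∀

module _ (M i j : ℕ) where

  private
    fˣ fʸ fˣʸ : Field
    fˣ x y = cap M x
    fʸ x y = cap M y
    fˣʸ x y = 4 * (x * y)

    row : ∀ c a b → a + b + c ≤ 2 * fʸ 0 (suc j) → fʸ 0 (suc j) + fʸ 0 (suc j) + (a + b) + c ≤ 4 * fʸ 0 (suc j)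
    row c a b le = ≤-by 0 le (ring (fʸ 0 (suc j)) a b c)
      where
      ring : ∀ q a b c → q + q + (a + b) + c + 2 * q + 0 ≡ 4 * q + (a + b + c)
      ring = solve-∀
    column : ∀ c a b → a + b + c ≤ 2 * fˣ (suc i) 0 → a + b + (fˣ (suc i) 0 + fˣ (suc i) 0) + c ≤ 4 * fˣ (suc i) 0
    column c a b le = ≤-by 0 le (ring (fˣ (suc i) 0) a b c)
      where
      ring : ∀ q a b c → a + b + (q + q) + c + 2 * q + 0 ≡ 4 * q + (a + b + c)
      ring = solve-∀

    fʸ-sup : nb fʸ i j ≤ 4 * fʸ (suc i) (suc j)
    fʸ-sup = +0-elim (row 0 (cap M j) (cap M (suc (suc j))) (+0-intro (cap-concave M j)))
    fˣ-sup : nb fˣ i j ≤ 4 * fˣ (suc i) (suc j)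
    fˣ-sup = +0-elim (column 0 (cap M i) (cap M (suc (suc i))) (+0-intro (cap-concave M i)))

    g₁ g₂ : Field
    g₁ x y = fˣʸ x y ⊓ fʸ x y
    g₂ x y = fˣʸ x y ⊓ fˣ x y

    g₁-sup : nb g₁ i j ≤ 4 * g₁ (suc i) (suc j)
    g₁-sup = ⊓-superharmonic fˣʸ fʸ i j (≤-reflexive (xy-harmonic i j)) fʸ-sup
    g₂-sup : nb g₂ i j ≤ 4 * g₂ (suc i) (suc j)
    g₂-sup = ⊓-superharmonic fˣʸ fˣ i j (≤-reflexive (xy-harmonic i j)) fˣ-sup

    sum-sup : ∀ c₁ c₂ → nb g₁ i j + c₁ ≤ 4 * g₁ (suc i) (suc j) → nb g₂ i j + c₂ ≤ 4 * g₂ (suc i) (suc j) →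
      nb (bump M) i j + (c₁ + c₂) ≤ 4 * bump M (suc i) (suc j)
    sum-sup c₁ c₂ le₁ le₂ = begin
      nb (bump M) i j + (c₁ + c₂)               ≡⟨ cong (_+ (c₁ + c₂)) (nb-+ g₁ g₂ i j) ⟩
      nb g₁ i j + nb g₂ i j + (c₁ + c₂)         ≡⟨ ring (nb g₁ i j) (nb g₂ i j) c₁ c₂ ⟩
      nb g₁ i j + c₁ + (nb g₂ i j + c₂)         ≤⟨ +-mono-≤ le₁ le₂ ⟩
      4 * g₁ (suc i) (suc j) + 4 * g₂ (suc i) (suc j) ≡⟨ *-distribˡ-+ 4 (g₁ (suc i) (suc j)) (g₂ (suc i) (suc j)) ⟨
      4 * bump M (suc i) (suc j)                ∎
      where
      open ≤-Reasoning
      ring : ∀ a b c d → a + b + (c + d) ≡ a + c + (b + d)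
      ring = solve-∀

  bump-superharmonic : nb (bump M) i j ≤ 4 * bump M (suc i) (suc j)
  bump-superharmonic = +0-elim (sum-sup 0 0 (+0-intro g₁-sup) (+0-intro g₂-sup))

  bump-strict : suc i ≤ M → suc j ≤ M → M ≤ 2 * suc i ⊎ M ≤ 2 * suc j →
    nb (bump M) i j + 1 ≤ 4 * bump M (suc i) (suc j)
  bump-strict i<M j<M (inj₁ M≤2i) = sum-sup 1 0
      (⊓-strict fˣʸ fʸ i j (row 1 (cap M j) (cap M (suc (suc j))) (cap-strictly-concave M j j<M)) below)
          (+0-intro g₂-sup)
    where
    ring : ∀ a b → 2 * (2 * a * b) ≡ 4 * (a * b)
    ring = solve-∀
    below : cap M (suc j) ≤ 4 * (suc i * suc j)
    below = ≤-trans (cap-linear M (suc j)) (≤-trans (*-monoʳ-≤ 2 (*-monoˡ-≤ (suc j) M≤2i))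
        (≤-reflexive (ring (suc i) (suc j))))
  bump-strict i<M j<M (inj₂ M≤2j) = sum-sup 0 1 (+0-intro g₁-sup)
      (⊓-strict fˣʸ fˣ i j (column 1 (cap M i) (cap M (suc (suc i))) (cap-strictly-concave M i i<M)) below)
    where
    ring : ∀ a b → 2 * (2 * b * a) ≡ 4 * (a * b)
    ring = solve-∀
    below : cap M (suc i) ≤ 4 * (suc i * suc j)
    below = ≤-trans (cap-linear M (suc i)) (≤-trans (*-monoʳ-≤ 2 (*-monoˡ-≤ (suc i) M≤2j))
        (≤-reflexive (ring (suc i) (suc j))))

-- A sum over the dyadic scales 1, 2, 4, ..., 2 ^ K. For each vertex with coordinates at most 2 ^ K,
-- one scale M satisfies M/2 ≤ max x y ≤ M; its bump supplies the strict drop, and the other bumps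
-- do no harm. Each scale adds at most 8xy, whence the logarithm.
exit-bound : ℕ → Field
exit-bound zero x y = bump 1 x y
exit-bound (suc K) x y = exit-bound K x y + bump (2 ^ suc K) x y

exit-bound-superharmonic : ∀ K i j → nb (exit-bound K) i j ≤ 4 * exit-bound K (suc i) (suc j)
exit-bound-superharmonic zero i j = bump-superharmonic 1 i j
exit-bound-superharmonic (suc K) i j = begin
  nb (exit-bound (suc K)) i j                       ≡⟨ nb-+ (exit-bound K) (bump (2 ^ suc K)) i j ⟩
  nb (exit-bound K) i j + nb (bump (2 ^ suc K)) i j
      ≤⟨ +-mono-≤ (exit-bound-superharmonic K i j) (bump-superharmonic (2 ^ suc K) i j) ⟩
  _
      ≡⟨ *-distribˡ-+ 4 (exit-bound K (suc i) (suc j)) (bump (2 ^ suc K) (suc i) (suc j)) ⟨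
  4 * exit-bound (suc K) (suc i) (suc j)            ∎
  where open ≤-Reasoning

exit-bound-strict : ∀ K i j → suc i ≤ 2 ^ K → suc j ≤ 2 ^ K → nb (exit-bound K) i j + 1 ≤
    4 * exit-bound K (suc i) (suc j)
exit-bound-strict zero i j i< j< = bump-strict 1 i j i< j< (inj₁ (m≤m+n 1 _))
exit-bound-strict (suc K) i j i< j< = cases (suc i ≤? 2 ^ K) (suc j ≤? 2 ^ K)
  where
  split : ∀ a b c₁ c₂ p q → a + c₁ ≤ 4 * p → b + c₂ ≤ 4 * q → a + b + (c₁ + c₂) ≤ 4 * (p + q)
  split a b c₁ c₂ p q le₁ le₂ = ≤-by 0 (+-mono-≤ le₁ le₂) (ring a b c₁ c₂ p q)
    where
    ring : ∀ a b c d p q → a + b + (c + d) + (4 * p + 4 * q) + 0 ≡ 4 * (p + q) + (a + c + (b + d))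
    ring = solve-∀
  combine : ∀ c₁ c₂ → nb (exit-bound K) i j + c₁ ≤ 4 * exit-bound K (suc i) (suc j) →
    nb (bump (2 ^ suc K)) i j + c₂ ≤ 4 * bump (2 ^ suc K) (suc i) (suc j) →
    nb (exit-bound (suc K)) i j + (c₁ + c₂) ≤ 4 * exit-bound (suc K) (suc i) (suc j)
  combine c₁ c₂ le₁ le₂ = subst (λ a → a + (c₁ + c₂) ≤ 4 * exit-bound (suc K) (suc i) (suc j))
      (sym (nb-+ (exit-bound K) (bump (2 ^ suc K)) i j))
    (split (nb (exit-bound K) i j) (nb (bump (2 ^ suc K)) i j) c₁ c₂ (exit-bound K (suc i) (suc j))
        (bump (2 ^ suc K) (suc i) (suc j)) le₁ le₂)
  from-bump : 2 ^ suc K ≤ 2 * suc i ⊎ 2 ^ suc K ≤ 2 * suc j → nb (exit-bound (suc K)) i j + 1 ≤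
      4 * exit-bound (suc K) (suc i) (suc j)
  from-bump large = combine 0 1 (+0-intro (exit-bound-superharmonic K i j))
    (bump-strict (2 ^ suc K) i j i< j< large)
  cases : Dec (suc i ≤ 2 ^ K) → Dec (suc j ≤ 2 ^ K) → nb (exit-bound (suc K)) i j + 1 ≤
      4 * exit-bound (suc K) (suc i) (suc j)
  cases (no i≰) _ = from-bump (inj₁ (*-monoʳ-≤ 2 (<⇒≤ (≰⇒> i≰))))
  cases (yes _) (no j≰) = from-bump (inj₂ (*-monoʳ-≤ 2 (<⇒≤ (≰⇒> j≰))))
  cases (yes i≤) (yes j≤) = combine 1 0 (exit-bound-strict K i j i≤ j≤)
    (+0-intro (bump-superharmonic (2 ^ suc K) i j))

exit-bound≤ : ∀ K x y → exit-bound K x y ≤ suc K * (8 * (x * y))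
exit-bound≤ zero x y = ≤-trans (+-mono-≤ (m⊓n≤m (4 * (x * y)) (cap 1 y)) (m⊓n≤m (4 * (x * y)) (cap 1 x)))
    (≤-reflexive (ring (x * y)))
  where
  ring : ∀ a → 4 * a + 4 * a ≡ 1 * (8 * a)
  ring = solve-∀
exit-bound≤ (suc K) x y = ≤-trans (+-mono-≤ (exit-bound≤ K x y)
    (+-mono-≤ (m⊓n≤m (4 * (x * y)) (cap (2 ^ suc K) y)) (m⊓n≤m (4 * (x * y)) (cap (2 ^ suc K) x))))
        (≤-reflexive (ring K (x * y)))
  where
  ring : ∀ k a → (1 + k) * (8 * a) + (4 * a + 4 * a) ≡ (2 + k) * (8 * a)
  ring = solve-∀

-- A function that is subharmonic away from the middle of the grid

-- The profile is the cubic t(α + t²) at distance t ≤ T from the sides and a parabola in between. Relative to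
-- its value, its second difference is 6t / t(α + t²) ≥ 6 / (α + T²) near the sides and at least
-- −6T / T(α + T²) in the middle, so in a product of two profiles a steep factor outweighs a flat one.
module Profile (α T n : ℕ) (1≤T : 1 ≤ T) (room : α + 9 * (T * T) ≤ 3 * (T * suc n)) where

  N cubic-top : ℕ
  N = suc n

  cubic : ℕ → ℕ
  cubic t = t * (α + t * t)

  cubic-top = cubic T

  -- The arguments are the distances to the two sides, so that reflection exchanges them. If a + b =
  -- N, then ab + T² - TN = (a - T)(b - T): the parabola meets the cubics exactly at distance T.
  profile′ : ℕ → ℕ → ℕ
  profile′ a b with a ≤? T | b ≤? T
  ... | yes _ | _     = cubic a
  ... | no _  | yes _ = cubic b
  ... | no _  | no _  = cubic-top + 3 * T * (a * b + T * T ∸ T * N)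

  profile : ℕ → ℕ
  profile x = profile′ x (N ∸ x)

  cubic-mono : ∀ {s t} → s ≤ t → cubic s ≤ cubic t
  cubic-mono s≤t = *-mono-≤ s≤t (+-monoʳ-≤ α (*-mono-≤ s≤t s≤t))

  3T≤N : 3 * T ≤ N
  3T≤N = *-cancelˡ-≤ (3 * T) {{>-nonZero (*-mono-≤ {1} {3} (s≤s z≤n) 1≤T)}}
      (≤-trans (≤-trans (≤-reflexive (ring₁ T)) (m≤n+m _ α)) (≤-trans room (≤-reflexive (sym (*-assoc 3 T N)))))
    where
    ring₁ : ∀ T → 3 * T * (3 * T) ≡ 9 * (T * T)
    ring₁ = solve-∀

  not-both : ∀ {a b} → a + b ≡ N → a ≤ T → ¬ b ≤ T
  not-both {a} {b} a+b≡N a≤T b≤T = <⇒≱ (begin-strict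
    N         ≡⟨ a+b≡N ⟨
    a + b     ≤⟨ +-mono-≤ a≤T b≤T ⟩
    T + T     <⟨ +-mono-<-≤ {T} {T + T} {T} (m<m+n T 1≤T) ≤-refl ⟩
    T + T + T ≡⟨ ring T ⟩
    3 * T     ∎) 3T≤N
    where
    open ≤-Reasoning
    ring : ∀ T → T + T + T ≡ 3 * T
    ring = solve-∀

  profile-left : ∀ a b → a ≤ T → profile′ a b ≡ cubic a
  profile-left a b a≤T with a ≤? T | b ≤? T
  ... | yes _ | _ = refl
  ... | no a≰T | _ = contradiction a≤T a≰T

  profile-right : ∀ a b → a + b ≡ N → b ≤ T → profile′ a b ≡ cubic b
  profile-right a b a+b≡N b≤T with a ≤? T | b ≤? T
  ... | yes a≤T | _ = contradiction b≤T (not-both a+b≡N a≤T)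
  ... | no _ | yes _ = refl
  ... | no _ | no b≰T = contradiction b≤T b≰T

  TN≤ : ∀ {a b} → a + b ≡ N → T ≤ a → T ≤ b → T * N ≤ a * b + T * T
  TN≤ {a} {b} a+b≡N T≤a T≤b = subst (λ N → T * N ≤ a * b + T * T) a+b≡N
    (subst₂ (λ a b → T * (a + b) ≤ a * b + T * T) (m+[n∸m]≡n T≤a) (m+[n∸m]≡n T≤b)
      (≤-by ((a ∸ T) * (b ∸ T)) ≤-refl (ring T (a ∸ T) (b ∸ T))))
    where
    ring : ∀ T c d → T * (T + c + (T + d)) + 0 + c * d ≡ (T + c) * (T + d) + T * T + 0
    ring = solve-∀

  profile-middle : ∀ a b → a + b ≡ N → T ≤ a → T ≤ b →
    profile′ a b ≡ cubic-top + 3 * T * (a * b + T * T ∸ T * N)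
  profile-middle a b a+b≡N T≤a T≤b with a ≤? T | b ≤? T
  ... | no _ | no _ = refl
  ... | yes a≤T | _ with refl ← ≤-antisym a≤T T≤a = edge
    where
    edge : cubic-top ≡ cubic-top + 3 * T * (T * b + T * T ∸ T * N)
    edge = sym (trans (cong (λ e → cubic-top + 3 * T * e)
        (trans (cong (_∸ T * N) (trans (+-comm (T * b) (T * T))
            (trans (sym (*-distribˡ-+ T T b)) (cong (T *_) a+b≡N)))) (n∸n≡0 (T * N))))
      (trans (cong (cubic-top +_) (*-zeroʳ (3 * T))) (+-identityʳ _)))
  ... | no _ | yes b≤T with refl ← ≤-antisym b≤T T≤b = edge
    where
    edge : cubic-top ≡ cubic-top + 3 * T * (a * T + T * T ∸ T * N)
    edge = sym (trans (cong (λ e → cubic-top + 3 * T * e)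
        (trans (cong (_∸ T * N) (trans (sym (*-distribʳ-+ T a T)) (trans (cong (_* T) a+b≡N) (*-comm N T))))
            (n∸n≡0 (T * N))))
      (trans (cong (cubic-top +_) (*-zeroʳ (3 * T))) (+-identityʳ _)))

  profile-middle-≡ : ∀ a b → a + b ≡ N → T ≤ a → T ≤ b →
    profile′ a b + 3 * T * (T * N) ≡ cubic-top + 3 * T * (a * b + T * T)
  profile-middle-≡ a b a+b≡N T≤a T≤b = begin
    profile′ a b + 3 * T * (T * N)
        ≡⟨ cong (_+ 3 * T * (T * N)) (profile-middle a b a+b≡N T≤a T≤b) ⟩
    cubic-top + 3 * T * (a * b + T * T ∸ T * N) + 3 * T * (T * N)
        ≡⟨ ring cubic-top (3 * T) (a * b + T * T ∸ T * N) (T * N) ⟩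
    cubic-top + 3 * T * (a * b + T * T ∸ T * N + T * N)
        ≡⟨ cong (λ e → cubic-top + 3 * T * e) (m∸n+n≡m (TN≤ a+b≡N T≤a T≤b)) ⟩
    cubic-top + 3 * T * (a * b + T * T)                                 ∎
    where
    open ≡-Reasoning
    ring : ∀ c t d e → c + t * d + t * e ≡ c + t * (d + e)
    ring = solve-∀

  -- The hypothesis `room` says that at the join the slope α + 3T² of the cubic is at most the slope
  -- 3T(N - 2T) of the parabola. The kink is therefore convex, and the parabola continued towards
  -- the side stays below the cubic.
  cubic-above-parabola : ∀ a b → a + b ≡ N → a ≤ T → cubic-top + 3 * T * (a * b + T * T) ≤ cubic a + 3 * T * (T * N)
  cubic-above-parabola a b a+b≡N a≤T = subst (λ N → cubic-top + 3 * T * (a * b + T * T) ≤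
      cubic a + 3 * T * (T * N)) a+b≡N
    (with-gap (T ∸ a) (m+[n∸m]≡n a≤T))
    where
    with-gap : ∀ e → a + e ≡ T → T * (α + T * T) + 3 * T * (a * b + T * T) ≤ a * (α + a * a) + 3 * T * (T * (a + b))
    with-gap e refl = ≤-by (e * (6 * (a * e) + 5 * (e * e)))
        (*-monoʳ-≤ e (subst (λ N → α + 9 * ((a + e) * (a + e)) ≤ 3 * ((a + e) * N)) (sym a+b≡N) room)) (ring a b e α)
      where
      ring : ∀ a b e α → (a + e) * (α + (a + e) * (a + e)) + 3 * (a + e) * (a * b + (a + e) * (a + e))
                           + e * (3 * ((a + e) * (a + b))) + e * (6 * (a * e) + 5 * (e * e))
                         ≡ a * (α + a * a) + 3 * (a + e) * ((a + e) * (a + b)) + e * (α + 9 * ((a + e) * (a + e)))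
      ring = solve-∀

  -- The parabola is a global minorant that touches the profile in the middle part. Hence the second
  -- difference of the profile there, joins included, is at least the -6T of the parabola. The
  -- negative term of the parabola stands on the right because its values may be negative.
  parabola≤profile : ∀ a b → a + b ≡ N → cubic-top + 3 * T * (a * b + T * T) ≤ profile′ a b + 3 * T * (T * N)
  parabola≤profile a b a+b≡N = cases (≤-total a T) (≤-total b T)
    where
    Goal : ℕ → Set
    Goal p = cubic-top + 3 * T * (a * b + T * T) ≤ p + 3 * T * (T * N)
    cases : a ≤ T ⊎ T ≤ a → b ≤ T ⊎ T ≤ b → Goal (profile′ a b)
    cases (inj₁ a≤T) _ = subst Goal (sym (profile-left a b a≤T)) (cubic-above-parabola a b a+b≡N a≤T)
    cases (inj₂ _) (inj₁ b≤T) = subst Goal (sym (profile-right a b a+b≡N b≤T))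
      (subst (λ ab → cubic-top + 3 * T * (ab + T * T) ≤ cubic b + 3 * T * (T * N)) (*-comm b a)
        (cubic-above-parabola b a (trans (+-comm b a) a+b≡N) b≤T))
    cases (inj₂ T≤a) (inj₂ T≤b) = ≤-reflexive (sym (profile-middle-≡ a b a+b≡N T≤a T≤b))

  cubic-top≤middle : ∀ a b → a + b ≡ N → T ≤ a → T ≤ b → cubic-top ≤ profile′ a b
  cubic-top≤middle a b a+b≡N T≤a T≤b = ≤-trans (m≤m+n cubic-top _)
      (≤-reflexive (sym (profile-middle a b a+b≡N T≤a T≤b)))

  -- At distance d < T from a side both neighbours lie on the same cubic, whose second difference is
  -- 6d. The joins at distance T count as flat.
  data Shape (i b : ℕ) : Set where
    steep : ∀ d → d ≤ T → profile′ (suc i) (suc b) ≡ cubic d →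
      2 * profile′ (suc i) (suc b) + 6 * d ≤ profile′ i (suc (suc b)) + profile′ (suc (suc i)) b → Shape i b
    flat : T ≤ suc i → T ≤ suc b → Shape i b

  cubic-second-difference : ∀ i → 2 * cubic (suc i) + 6 * suc i ≡ cubic i + cubic (suc (suc i))
  cubic-second-difference i = ring α i
    where
    ring : ∀ α i → 2 * ((1 + i) * (α + (1 + i) * (1 + i))) + 6 * (1 + i) ≡
        i * (α + i * i) + (2 + i) * (α + (2 + i) * (2 + i))
    ring = solve-∀

  shape : ∀ i b → suc i + suc b ≡ N → Shape i b
  shape i b eq with T ≤? suc i | T ≤? suc b
  ... | yes T≤i | yes T≤b = flat T≤i T≤b
  ... | no T≰i | _ = steep (suc i) (<⇒≤ i<T) (profile-left (suc i) (suc b) (<⇒≤ i<T)) (≤-reflexive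
      (trans (cong (λ p → 2 * p + 6 * suc i) (profile-left (suc i) (suc b) (<⇒≤ i<T)))
      (trans (cubic-second-difference i)
        (sym (cong₂ _+_ (profile-left i (suc (suc b)) (≤-trans (n≤1+n i) (<⇒≤ i<T)))
            (profile-left (suc (suc i)) b i<T))))))
    where
    i<T : suc i < T
    i<T = ≰⇒> T≰i
  ... | yes _ | no T≰b = steep (suc b) (<⇒≤ b<T) (profile-right (suc i) (suc b) eq (<⇒≤ b<T)) (≤-reflexive
      (trans (cong (λ p → 2 * p + 6 * suc b) (profile-right (suc i) (suc b) eq (<⇒≤ b<T)))
      (trans (cubic-second-difference b) (trans (+-comm (cubic b) _)
        (sym (cong₂ _+_ (profile-right i (suc (suc b)) (trans (+-suc i (suc b)) eq) b<T)
          (profile-right (suc (suc i)) b (trans (sym (+-suc (suc i) b)) eq) (≤-trans (n≤1+n b) (<⇒≤ b<T)))))))))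
    where
    b<T : suc b < T
    b<T = ≰⇒> T≰b

  almost-convex : ∀ i b → suc i + suc b ≡ N →
    2 * profile′ (suc i) (suc b) ≤ profile′ i (suc (suc b)) + profile′ (suc (suc i)) b + 6 * T
  almost-convex i b eq with shape i b eq
  ... | steep d _ _ le = ≤-trans (m≤m+n _ (6 * d)) (≤-trans le (m≤m+n _ (6 * T)))
  ... | flat T≤i T≤b = ≤-by 0 (+-mono-≤ (+-mono-≤ (parabola≤profile i (suc (suc b)) (trans (+-suc i (suc b)) eq))
                                                    (parabola≤profile (suc (suc i)) b
                                                        (trans (sym (+-suc (suc i) b)) eq)))
                                         (*-monoʳ-≤ 2 (≤-reflexive (profile-middle-≡ (suc i) (suc b) eq T≤i T≤b))))
      (ring i b T cubic-top (profile′ (suc i) (suc b)) (profile′ i (suc (suc b))) (profile′ (suc (suc i)) b) (T * N))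
    where
    ring : ∀ i b T C p q r M →
      2 * p + (q + 3 * T * M + (r + 3 * T * M) + 2 * (C + 3 * T * ((1 + i) * (1 + b) + T * T))) + 0 ≡
      q + r + 6 * T + (C + 3 * T * (i * (2 + b) + T * T) + (C + 3 * T * ((2 + i) * b + T * T)) + 2 * (p + 3 * T * M))
    ring = solve-∀

  opposite : ∀ {i b} → suc i + suc b ≡ N → N ∸ i ≡ suc (suc b) × N ∸ suc i ≡ suc b × n ∸ suc i ≡ b
  opposite {i} {b} eq =
    trans (cong (_∸ i) (trans (sym eq) (sym (+-suc i (suc b))))) (m+n∸m≡n i (suc (suc b))) ,
    trans (cong (_∸ suc i) (sym eq)) (m+n∸m≡n (suc i) (suc b)) ,
    trans (cong (_∸ suc i) (suc-injective (trans (sym eq) (cong suc (+-suc i b))))) (m+n∸m≡n (suc i) b)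

  Flat : ℕ → Set
  Flat x = T ≤ x × x + T ≤ N

  Steep : ℕ → Set
  Steep i = Σ ℕ λ d → d ≤ T × profile (suc i) ≡ cubic d × 2 * profile (suc i) + 6 * d ≤
      profile i + profile (suc (suc i))

  private
    complement : ∀ {i} → i < n → Σ ℕ λ b → suc i + suc b ≡ N
    complement {i} i<n = n ∸ suc i , trans (+-suc (suc i) (n ∸ suc i)) (cong suc (m+[n∸m]≡n i<n))

  shapeAt : ∀ {i} → i < n → Flat (suc i) ⊎ Steep i
  shapeAt {i} i<n with b , eq ← complement i<n
    with e₀ , e₁ , e₂ ← opposite eq rewrite e₀ | e₁ | e₂ with shape i b eq
  ... | flat T≤i T≤b = inj₁ (T≤i , subst (suc i + T ≤_) eq (+-monoʳ-≤ (suc i) T≤b))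
  ... | steep d d≤T p≡ le = inj₂ (d , d≤T , p≡ , le)

  profile-almost-convex : ∀ {i} → i < n → 2 * profile (suc i) ≤ profile i + profile (suc (suc i)) + 6 * T
  profile-almost-convex {i} i<n with b , eq ← complement i<n
    with e₀ , e₁ , e₂ ← opposite eq rewrite e₀ | e₁ | e₂ = almost-convex i b eq

  cubic-top≤profile : ∀ {x} → Flat x → cubic-top ≤ profile x
  cubic-top≤profile {x} (T≤x , x+T≤N) = cubic-top≤middle x (N ∸ x) (m+[n∸m]≡n (m+n≤o⇒m≤o x x+T≤N)) T≤x
    (m+n≤o⇒m≤o∸n T (subst (_≤ N) (+-comm x T) x+T≤N))

  profile-zero : ∀ {x} → x ≡ 0 ⊎ N ≤ x → profile x ≡ 0
  profile-zero (inj₁ refl) = profile-left 0 N z≤n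
  profile-zero {x} (inj₂ N≤x) rewrite m≤n⇒m∸n≡0 N≤x with x ≤? T
  ... | yes x≤T = contradiction (≤-trans 3T≤N (≤-trans N≤x x≤T)) (<⇒≱ (m<m+n T (≤-trans 1≤T (m≤m+n T _))))
  ... | no _ = refl

  profile≤ : ∀ x → profile x ≤ cubic-top + 3 * T * (N * N)
  profile≤ x with x ≤? N
  ... | no x≰N = ≤-trans (≤-reflexive (profile-zero (inj₂ (<⇒≤ (≰⇒> x≰N))))) z≤n
  ... | yes x≤N with x ≤? T | N ∸ x ≤? T
  ...   | yes x≤T | _ = ≤-trans (cubic-mono x≤T) (m≤m+n _ _)
  ...   | no _ | yes b≤T = ≤-trans (cubic-mono b≤T) (m≤m+n _ _)
  ...   | no _ | no _ = +-monoʳ-≤ cubic-top (*-monoʳ-≤ (3 * T) (≤-trans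
      (m≤n+o⇒m∸n≤o (x * (N ∸ x) + T * T) (T * N)
          (subst (_≤ T * N + x * (N ∸ x)) (+-comm (T * T) _) (+-monoˡ-≤ (x * (N ∸ x)) (*-monoʳ-≤ T T≤N))))
      (*-mono-≤ x≤N (m∸n≤m N x))))
    where
    T≤N : T ≤ N
    T≤N = ≤-trans (m≤n*m T 3) 3T≤N

  α≤profile : ∀ {i} → i < n → α ≤ profile (suc i)
  α≤profile {i} i<n with suc i ≤? T | n ∸ i ≤? T
  ... | yes _ | _ = ≤-trans (m≤m+n α _) (m≤n*m _ (suc i))
  ... | no _ | yes _ = ≤-trans (m≤m+n α _) (m≤n*m _ (n ∸ i) {{>-nonZero (m<n⇒0<n∸m i<n)}})
  ... | no _ | no _ = ≤-trans (m≤m+n α _) (≤-trans (m≤n*m _ T {{>-nonZero 1≤T}}) (m≤m+n _ _))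

  -- This linear growth up to the midpoint is what matches the factor xy in `exit-bound≤`. In the
  -- middle part it follows from αx ≤ αN/2 ≤ `cubic-top`.
  αx≤profile : α * N ≤ 2 * cubic-top → ∀ {x} → 2 * x ≤ N → α * x ≤ profile x
  αx≤profile αN≤ {x} 2x≤N with x ≤? T | N ∸ x ≤? T
  ... | yes _ | _ = ≤-trans (≤-reflexive (*-comm α x)) (*-monoʳ-≤ x (m≤m+n α _))
  ... | no x≰T | yes b≤T = contradiction (≤-trans x≤N∸x b≤T) x≰T
    where
    x≤N∸x : x ≤ N ∸ x
    x≤N∸x = m+n≤o⇒m≤o∸n x (subst (λ y → x + y ≤ N) (+-identityʳ x) 2x≤N)
  ... | no _ | no _ = ≤-trans (*-cancelˡ-≤ {α * x} {cubic-top} 2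
      (≤-trans (≤-trans (≤-reflexive (ring α x)) (*-monoʳ-≤ α 2x≤N)) αN≤)) (m≤m+n cubic-top _)
    where
    ring : ∀ α x → 2 * (α * x) ≡ α * (2 * x)
    ring = solve-∀

  weight : Field
  weight x y = profile x * profile y

  convex-product : ∀ {a₀ a a₂ b₀ b b₂} d t → 2 * a + 6 * d ≤ a₀ + a₂ → 2 * b ≤ b₀ + b₂ + 6 * t → t * a ≤ d * b →
    4 * (a * b) ≤ a₀ * b + a₂ * b + (a * b₀ + a * b₂)
  convex-product {a₀} {a} {a₂} {b₀} {b} {b₂} d t le₁ le₂ le₃ =
    ≤-by 0 (+-mono-≤ (+-mono-≤ (*-monoʳ-≤ b le₁) (*-monoʳ-≤ a le₂)) (*-monoʳ-≤ 6 le₃)) (ring a₀ a a₂ b₀ b b₂ d t)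
    where
    ring : ∀ a₀ a a₂ b₀ b b₂ d t → 4 * (a * b) + (b * (a₀ + a₂) + a * (b₀ + b₂ + 6 * t) + 6 * (d * b)) + 0 ≡
      a₀ * b + a₂ * b + (a * b₀ + a * b₂) + (b * (2 * a + 6 * d) + a * (2 * b) + 6 * (t * a))
    ring = solve-∀

  weight-from-convex : ∀ i j d t → 2 * profile (suc i) + 6 * d ≤ profile i + profile (suc (suc i)) →
    2 * profile (suc j) ≤ profile j + profile (suc (suc j)) + 6 * t → t * profile (suc i) ≤ d * profile (suc j) →
    4 * weight (suc i) (suc j) ≤ nb weight i j
  weight-from-convex i j = convex-product {profile i} {profile (suc i)} {profile (suc (suc i))} {profile j}
      {profile (suc j)} {profile (suc (suc j))}

  weight-swap : ∀ i j → nb weight i j ≡ nb weight j i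
  weight-swap i j = ring (profile i) (profile (suc i)) (profile (suc (suc i))) (profile j) (profile (suc j))
      (profile (suc (suc j)))
    where
    ring : ∀ a b c d e f → a * e + c * e + (b * d + b * f) ≡ d * b + f * b + (e * a + e * c)
    ring = solve-∀

  steep-flat : ∀ {i x d} → profile (suc i) ≡ cubic d → d ≤ T → Flat x → T * profile (suc i) ≤ d * profile x
  steep-flat {i} {x} {d} p≡ d≤T flatₓ = begin
    T * profile (suc i)       ≡⟨ cong (T *_) p≡ ⟩
    T * (d * (α + d * d))     ≡⟨ ring T d (α + d * d) ⟩
    d * (T * (α + d * d))     ≤⟨ *-monoʳ-≤ d (*-monoʳ-≤ T (+-monoʳ-≤ α (*-mono-≤ d≤T d≤T))) ⟩
    d * cubic-top             ≤⟨ *-monoʳ-≤ d (cubic-top≤profile flatₓ) ⟩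
    d * profile x             ∎
    where
    open ≤-Reasoning
    ring : ∀ a b c → a * (b * c) ≡ b * (a * c)
    ring = solve-∀

  weight-subharmonic : ∀ {i j} → i < n → j < n → (Flat (suc i) × Flat (suc j)) ⊎ 4 * weight (suc i) (suc j) ≤
      nb weight i j
  weight-subharmonic {i} {j} i<n j<n with shapeAt i<n | shapeAt j<n
  ... | inj₁ flatᵢ | inj₁ flatⱼ = inj₁ (flatᵢ , flatⱼ)
  ... | inj₂ (d , d≤T , p≡ , convex) | inj₁ flatⱼ = inj₂
      (weight-from-convex i j d T convex (profile-almost-convex j<n) (steep-flat {i} p≡ d≤T flatⱼ))
  ... | inj₁ flatᵢ | inj₂ (d , d≤T , p≡ , convex) = inj₂
    (subst₂ _≤_ (cong (4 *_) (*-comm (profile (suc j)) (profile (suc i)))) (weight-swap j i)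
      (weight-from-convex j i d T convex (profile-almost-convex i<n) (steep-flat {j} p≡ d≤T flatᵢ)))
  ... | inj₂ (d , d≤T , p≡ , convex) | inj₂ (e , e≤T , q≡ , convex′) = inj₂
    (weight-from-convex i j 0 0 (+0-intro (m+n≤o⇒m≤o (2 * profile (suc i)) convex))
      (≤-trans (m+n≤o⇒m≤o (2 * profile (suc j)) convex′) (m≤m+n _ 0)) z≤n)

  -- Limits the failure of subharmonicity inside the box; `mass-bound` pays for it with the bound on
  -- u there.
  weight-almost-subharmonic : ∀ {i j} → i < n → j < n →
    4 * weight (suc i) (suc j) ≤ nb weight i j + 12 * T * (cubic-top + 3 * T * (N * N))
  weight-almost-subharmonic {i} {j} i<n j<n = ≤-by 0
    (+-mono-≤ (+-mono-≤ (*-monoʳ-≤ (profile (suc j)) (profile-almost-convex i<n))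
        (*-monoʳ-≤ (profile (suc i)) (profile-almost-convex j<n)))
              (*-monoʳ-≤ (6 * T) (+-mono-≤ (profile≤ (suc i)) (profile≤ (suc j)))))
    (ring (profile i) (profile (suc i)) (profile (suc (suc i))) (profile j) (profile (suc j))
        (profile (suc (suc j))) T (cubic-top + 3 * T * (N * N)))
    where
    ring : ∀ a₀ a a₂ b₀ b b₂ t P →
      4 * (a * b) + (b * (a₀ + a₂ + 6 * t) + a * (b₀ + b₂ + 6 * t) + 6 * t * (P + P)) + 0 ≡
      a₀ * b + a₂ * b + (a * b₀ + a * b₂) + 12 * t * P + (b * (2 * a) + a * (2 * b) + 6 * t * (a + b))
    ring = solve-∀

-- Summation by parts

∑ : ℕ → (ℕ → ℕ) → ℕ
∑ zero f = 0
∑ (suc n) f = ∑ n f + f n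

∑-cong : ∀ n {f g} → (∀ i → i < n → f i ≡ g i) → ∑ n f ≡ ∑ n g
∑-cong zero f≡g = refl
∑-cong (suc n) f≡g = cong₂ _+_ (∑-cong n λ i i<n → f≡g i (m<n⇒m<1+n i<n)) (f≡g n ≤-refl)

∑-mono : ∀ n {f g} → (∀ i → i < n → f i ≤ g i) → ∑ n f ≤ ∑ n g
∑-mono zero f≤g = z≤n
∑-mono (suc n) f≤g = +-mono-≤ (∑-mono n λ i i<n → f≤g i (m<n⇒m<1+n i<n)) (f≤g n ≤-refl)

∑-+ : ∀ n f g → ∑ n (λ i → f i + g i) ≡ ∑ n f + ∑ n g
∑-+ zero f g = refl
∑-+ (suc n) f g = trans (cong (_+ (f n + g n)) (∑-+ n f g)) (ring (∑ n f) (∑ n g) (f n) (g n))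
  where
  ring : ∀ a b c d → a + b + (c + d) ≡ a + c + (b + d)
  ring = solve-∀

∑-*ʳ : ∀ n f c → ∑ n (λ i → f i * c) ≡ ∑ n f * c
∑-*ʳ zero f c = refl
∑-*ʳ (suc n) f c = trans (cong (_+ f n * c) (∑-*ʳ n f c)) (sym (*-distribʳ-+ c (∑ n f) (f n)))

∑-*ˡ : ∀ n f c → ∑ n (λ i → c * f i) ≡ c * ∑ n f
∑-*ˡ n f c = trans (∑-cong n λ i _ → *-comm c (f i)) (trans (∑-*ʳ n f c) (*-comm (∑ n f) c))

∑-const : ∀ n c → ∑ n (λ _ → c) ≡ n * c
∑-const zero c = refl
∑-const (suc n) c = trans (cong (_+ c) (∑-const n c)) (+-comm (n * c) c)

∑-swap : ∀ m n (F : Field) → ∑ m (λ i → ∑ n (F i)) ≡ ∑ n (λ j → ∑ m (λ i → F i j))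
∑-swap zero n F = sym (trans (∑-const n 0) (*-zeroʳ n))
∑-swap (suc m) n F = trans (cong (_+ ∑ n (F m)) (∑-swap m n F)) (sym (∑-+ n (λ j → ∑ m (λ i → F i j)) (F m)))

-- The boundary terms are kept because vanishing at n + 1 would not survive the induction on n.
∑-by-parts-boundary : ∀ n (f g : ℕ → ℕ) →
  ∑ n (λ i → g (suc i) * (f i + f (suc (suc i)))) + (g 0 * f 1 + g (suc n) * f n) ≡
  ∑ n (λ i → f (suc i) * (g i + g (suc (suc i)))) + (f 0 * g 1 + f (suc n) * g n)
∑-by-parts-boundary zero f g = ring (f 0) (f 1) (g 0) (g 1)
  where
  ring : ∀ a b c d → c * b + d * a ≡ a * d + b * c
  ring = solve-∀
∑-by-parts-boundary (suc n) f g = ≡-by (∑-by-parts-boundary n f g)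
  (ring (∑ n (λ i → g (suc i) * (f i + f (suc (suc i))))) (∑ n (λ i → f (suc i) * (g i + g (suc (suc i)))))
    (g 0 * f 1) (f 0 * g 1) (f n) (f (suc n)) (f (suc (suc n))) (g n) (g (suc n)) (g (suc (suc n))))
  where
  ring : ∀ S S′ p q a b c d e k →
    S + e * (a + c) + (p + k * b) + (S′ + (q + b * d)) ≡ S′ + b * (d + k) + (q + c * e) + (S + (p + e * a))
  ring = solve-∀

∑-by-parts : ∀ n (f g : ℕ → ℕ) → f 0 ≡ 0 → g 0 ≡ 0 → f (suc n) ≡ 0 → g (suc n) ≡ 0 →
  ∑ n (λ i → g (suc i) * (f i + f (suc (suc i)))) ≡ ∑ n (λ i → f (suc i) * (g i + g (suc (suc i))))
∑-by-parts n f g f₀ g₀ fₙ gₙ = +-cancelʳ-≡ 0 _ _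
    (subst₂ (λ a b → ∑ n (λ i → g (suc i) * (f i + f (suc (suc i)))) + a ≡
        ∑ n (λ i → f (suc i) * (g i + g (suc (suc i)))) + b) left right (∑-by-parts-boundary n f g))
  where
  left : g 0 * f 1 + g (suc n) * f n ≡ 0
  left rewrite g₀ | gₙ = refl
  right : f 0 * g 1 + f (suc n) * g n ≡ 0
  right rewrite f₀ | fₙ = refl

∑² : ℕ → Field → ℕ
∑² n F = ∑ n (λ i → ∑ n (F i))

∑²-cong : ∀ n {F G : Field} → (∀ i j → i < n → j < n → F i j ≡ G i j) → ∑² n F ≡ ∑² n G
∑²-cong n F≡G = ∑-cong n λ i i<n → ∑-cong n λ j j<n → F≡G i j i<n j<n

∑²-mono : ∀ n {F G : Field} → (∀ i j → i < n → j < n → F i j ≤ G i j) → ∑² n F ≤ ∑² n G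
∑²-mono n F≤G = ∑-mono n λ i i<n → ∑-mono n λ j j<n → F≤G i j i<n j<n

∑²-+ : ∀ n (F G : Field) → ∑² n (λ i j → F i j + G i j) ≡ ∑² n F + ∑² n G
∑²-+ n F G = trans (∑-cong n λ i _ → ∑-+ n (F i) (G i)) (∑-+ n (λ i → ∑ n (F i)) (λ i → ∑ n (G i)))

∑²-*ʳ : ∀ n (F : Field) c → ∑² n (λ i j → F i j * c) ≡ ∑² n F * c
∑²-*ʳ n F c = trans (∑-cong n λ i _ → ∑-*ʳ n (F i) c) (∑-*ʳ n (λ i → ∑ n (F i)) c)

∑²-const : ∀ n c → ∑² n (λ _ _ → c) ≡ n * (n * c)
∑²-const n c = trans (∑-cong n λ _ _ → ∑-const n c) (∑-const n (n * c))

record VanishesOutside (n : ℕ) (f : Field) : Set where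
  field
    west  : ∀ y → f 0 y ≡ 0
    east  : ∀ y → f (suc n) y ≡ 0
    south : ∀ x → f x 0 ≡ 0
    north : ∀ x → f x (suc n) ≡ 0

nb-self-adjoint : ∀ n (f g : Field) → VanishesOutside n f → VanishesOutside n g →
  ∑² n (λ i j → g (suc i) (suc j) * nb f i j) ≡ ∑² n (λ i j → f (suc i) (suc j) * nb g i j)
nb-self-adjoint n f g f-out g-out = begin
  ∑² n (λ i j → g (suc i) (suc j) * nb f i j)       ≡⟨ split f g ⟩
  ∑² n (horizontal f g) + ∑² n (vertical f g)       ≡⟨ cong₂ _+_ swap-horizontal swap-vertical ⟩
  ∑² n (horizontal g f) + ∑² n (vertical g f)       ≡⟨ split g f ⟨
  ∑² n (λ i j → f (suc i) (suc j) * nb g i j)       ∎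
  where
  open ≡-Reasoning
  module F = VanishesOutside f-out
  module G = VanishesOutside g-out
  horizontal vertical : Field → Field → Field
  horizontal f g i j = g (suc i) (suc j) * (f i (suc j) + f (suc (suc i)) (suc j))
  vertical f g i j = g (suc i) (suc j) * (f (suc i) j + f (suc i) (suc (suc j)))
  split : ∀ f g → ∑² n (λ i j → g (suc i) (suc j) * nb f i j) ≡ ∑² n (horizontal f g) + ∑² n (vertical f g)
  split f g = trans (∑²-cong n λ i j _ _ → *-distribˡ-+ (g (suc i) (suc j))
      (f i (suc j) + f (suc (suc i)) (suc j)) (f (suc i) j + f (suc i) (suc (suc j))))
                    (∑²-+ n (horizontal f g) (vertical f g))
  swap-vertical : ∑² n (vertical f g) ≡ ∑² n (vertical g f)
  swap-vertical = ∑-cong n λ i _ → ∑-by-parts n (f (suc i)) (g (suc i)) (F.south _) (G.south _) (F.north _)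
      (G.north _)
  swap-horizontal : ∑² n (horizontal f g) ≡ ∑² n (horizontal g f)
  swap-horizontal = trans (∑-swap n n (horizontal f g)) (trans
    (∑-cong n λ j _ → ∑-by-parts n (λ x → f x (suc j)) (λ x → g x (suc j)) (F.west _) (G.west _) (F.east _)
        (G.east _))
    (sym (∑-swap n n (horizontal g f))))

-- Comparison and summation against the weight

StrictlySuperharmonic : ℕ → Field → Set
StrictlySuperharmonic n v = ∀ i j → i < n → j < n → nb v i j + 1 ≤ 4 * v (suc i) (suc j)

inGrid? : ∀ n x → InGrid n x ⊎ (x ≡ 0 ⊎ suc n ≤ x)
inGrid? n zero = inj₂ (inj₁ refl)
inGrid? n (suc i) with i <? n
... | yes i<n = inj₁ (inside i<n)
... | no i≮n = inj₂ (inj₂ (s≤s (≮⇒≥ i≮n)))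

module Weighting (α T n : ℕ) (1≤T : 1 ≤ T) (room : α + 9 * (T * T) ≤ 3 * (T * suc n)) where

  open Profile α T n 1≤T room public

  P : ℕ
  P = cubic-top + 3 * T * (N * N)

  weight≤ : ∀ x y → weight x y ≤ P * P
  weight≤ x y = *-mono-≤ (profile≤ x) (profile≤ y)

  instance
    P-nonZero : NonZero (P * P)
    P-nonZero = >-nonZero (*-mono-≤ 1≤P 1≤P)
      where
      1≤P : 1 ≤ P
      1≤P = ≤-trans (*-mono-≤ 1≤T (≤-trans (*-mono-≤ 1≤T 1≤T) (m≤n+m (T * T) α))) (m≤m+n cubic-top _)

  -- Multiplying v by P² ≥ `weight` replaces normalizing the weight. On the box m · weight ≤ mP² ≤
  -- P²v, off the grid the weight is zero, and elsewhere it is subharmonic against a strictly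
  -- superharmonic function.
  lower-bound : ∀ v m → StrictlySuperharmonic n v → (∀ x y → Flat x → Flat y → m ≤ v x y) →
    ∀ x y → m * weight x y ≤ P * P * v x y
  lower-bound v m sup m≤v = maximum-principle (λ x y → P * P * v x y) (λ x y → m * weight x y) (m * (P * P))
    (λ x y → ≤-trans (*-monoʳ-≤ m (weight≤ x y)) (m≤n+m (m * (P * P)) (P * P * v x y))) local
    where
    vanishing : ∀ {p} x y → p ≡ 0 → weight x y ≡ p → m * weight x y ≤ P * P * v x y
    vanishing x y refl w≡0 = ≤-trans (≤-reflexive (trans (cong (m *_) w≡0) (*-zeroʳ m))) z≤n
    interior-case : ∀ {i j} → i < n → j < n → (Flat (suc i) × Flat (suc j)) ⊎ 4 * weight (suc i) (suc j) ≤
        nb weight i j →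
      m * weight (suc i) (suc j) ≤ P * P * v (suc i) (suc j) ⊎
          StrictAt (λ x y → P * P * v x y) (λ x y → m * weight x y) (suc i) (suc j)
    interior-case {i} {j} i<n j<n (inj₁ (flatᵢ , flatⱼ)) = inj₁
        (≤-trans (*-mono-≤ (m≤v _ _ flatᵢ flatⱼ) (weight≤ (suc i) (suc j)))
            (≤-reflexive (*-comm (v (suc i) (suc j)) (P * P))))
    interior-case {i} {j} i<n j<n (inj₂ sub) = inj₂ (interior
      (subst₂ _<_ (sym (nb-* (P * P) v i j)) (ring (P * P) (v (suc i) (suc j)))
        (*-monoʳ-< (P * P) (≤-trans (≤-reflexive (+-comm 1 (nb v i j))) (sup i j i<n j<n))))
      (subst₂ _≤_ (ring m (weight (suc i) (suc j))) (sym (nb-* m weight i j)) (*-monoʳ-≤ m sub)))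
      where
      ring : ∀ a b → a * (4 * b) ≡ 4 * (a * b)
      ring = solve-∀
    local : ∀ x y → m * weight x y ≤ P * P * v x y ⊎ StrictAt (λ x y → P * P * v x y) (λ x y → m * weight x y) x y
    local x y with inGrid? n x | inGrid? n y
    ... | inj₂ out | _ = inj₁ (vanishing x y refl (cong (_* profile y) (profile-zero out)))
    ... | inj₁ _ | inj₂ out = inj₁ (vanishing x y refl
        (trans (cong (profile x *_) (profile-zero out)) (*-zeroʳ (profile x))))
    ... | inj₁ (inside i<n) | inj₁ (inside j<n) = interior-case i<n j<n (weight-subharmonic i<n j<n)

  weight-vanishes : VanishesOutside n weight
  weight-vanishes = record
    { west  = λ y → cong (_* profile y) (profile-zero (inj₁ refl))
    ; east  = λ y → cong (_* profile y) (profile-zero (inj₂ ≤-refl))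
    ; south = λ x → trans (cong (profile x *_) (profile-zero (inj₁ refl))) (*-zeroʳ (profile x))
    ; north = λ x → trans (cong (profile x *_) (profile-zero (inj₂ ≤-refl))) (*-zeroʳ (profile x))
    }

  -- Testing the balance against the weight w and moving the Laplacian over gives ∑ wμ ≤ ∑ u(4w - nb
  -- w) + 3∑ w. The first summand on the right is positive only on the box, where u ≤ M and 4w - nb
  -- w ≤ 12TP; on the left w ≥ α².
  mass-bound : ∀ (u μ : Field) M → VanishesOutside n u →
    (∀ i j → i < n → j < n → μ i j + nb u i j ≤ 4 * u (suc i) (suc j) + 3) →
    (∀ x y → Flat x → Flat y → u x y ≤ M) →
    ∑² n μ * (α * α) ≤ n * (n * (3 * (P * P) + 12 * T * P * M))
  mass-bound u μ M u-out balance u≤M = begin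
    ∑² n μ * (α * α)                                  ≡⟨ ∑²-*ʳ n μ (α * α) ⟨
    ∑² n (λ i j → μ i j * (α * α))
        ≤⟨ ∑²-mono n (λ i j i<n j<n → ≤-trans (≤-reflexive (*-comm (μ i j) (α * α)))
            (*-monoˡ-≤ (μ i j) (*-mono-≤ (α≤profile i<n) (α≤profile j<n)))) ⟩
    ∑² n (λ i j → W i j * μ i j)
        ≤⟨ ≤-by 0 summed (ring₁ (∑² n (λ i j → W i j * μ i j)) (∑² n (λ i j → U i j * nb weight i j))
            (∑² n (λ _ _ → 3 * (P * P) + 12 * T * P * M))) ⟩
    ∑² n (λ _ _ → 3 * (P * P) + 12 * T * P * M)       ≡⟨ ∑²-const n _ ⟩
    n * (n * (3 * (P * P) + 12 * T * P * M))          ∎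
    where
    open ≤-Reasoning
    W U : Field
    W i j = weight (suc i) (suc j)
    U i j = u (suc i) (suc j)
    ring₁ : ∀ a b c → a + (b + c) + 0 ≡ c + (a + b)
    ring₁ = solve-∀
    pointwise : ∀ i j → i < n → j < n → W i j * μ i j + W i j * nb u i j ≤
        U i j * nb weight i j + (3 * (P * P) + 12 * T * P * M)
    pointwise i j i<n j<n = begin
      W i j * μ i j + W i j * nb u i j       ≡⟨ *-distribˡ-+ (W i j) (μ i j) (nb u i j) ⟨
      W i j * (μ i j + nb u i j)             ≤⟨ *-monoʳ-≤ (W i j) (balance i j i<n j<n) ⟩
      W i j * (4 * U i j + 3)                ≡⟨ ring (W i j) (U i j) ⟩
      3 * W i j + U i j * (4 * W i j)        ≤⟨ +-mono-≤ (*-monoʳ-≤ 3 (weight≤ (suc i) (suc j)))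
          (defect (weight-subharmonic i<n j<n)) ⟩
      3 * (P * P) + (U i j * nb weight i j + 12 * T * P * M)
          ≡⟨ ring₂ (3 * (P * P)) (U i j * nb weight i j) (12 * T * P * M) ⟩
      U i j * nb weight i j + (3 * (P * P) + 12 * T * P * M) ∎
      where
      ring : ∀ w u → w * (4 * u + 3) ≡ 3 * w + u * (4 * w)
      ring = solve-∀
      ring₂ : ∀ a b c → a + (b + c) ≡ b + (a + c)
      ring₂ = solve-∀
      defect : (Flat (suc i) × Flat (suc j)) ⊎ 4 * W i j ≤ nb weight i j → U i j * (4 * W i j) ≤
          U i j * nb weight i j + 12 * T * P * M
      defect (inj₂ sub) = ≤-trans (*-monoʳ-≤ (U i j) sub) (m≤m+n _ _)
      defect (inj₁ (flatᵢ , flatⱼ)) = begin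
        U i j * (4 * W i j)                           ≤⟨ *-monoʳ-≤ (U i j) (weight-almost-subharmonic i<n j<n) ⟩
        U i j * (nb weight i j + 12 * T * P)          ≡⟨ *-distribˡ-+ (U i j) (nb weight i j) (12 * T * P) ⟩
        U i j * nb weight i j + U i j * (12 * T * P)
            ≤⟨ +-monoʳ-≤ (U i j * nb weight i j)
                (≤-trans (*-monoˡ-≤ (12 * T * P) (u≤M _ _ flatᵢ flatⱼ)) (≤-reflexive (*-comm M (12 * T * P)))) ⟩
        U i j * nb weight i j + 12 * T * P * M        ∎
    summed : ∑² n (λ i j → W i j * μ i j) + ∑² n (λ i j → U i j * nb weight i j) ≤
             ∑² n (λ i j → U i j * nb weight i j) + ∑² n (λ _ _ → 3 * (P * P) + 12 * T * P * M)
    summed = begin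
      ∑² n (λ i j → W i j * μ i j) + ∑² n (λ i j → U i j * nb weight i j)
          ≡⟨ cong (∑² n (λ i j → W i j * μ i j) +_) (nb-self-adjoint n u weight u-out weight-vanishes) ⟨
      ∑² n (λ i j → W i j * μ i j) + ∑² n (λ i j → W i j * nb u i j)
          ≡⟨ ∑²-+ n (λ i j → W i j * μ i j) (λ i j → W i j * nb u i j) ⟨
      ∑² n (λ i j → W i j * μ i j + W i j * nb u i j)                     ≤⟨ ∑²-mono n pointwise ⟩
      ∑² n (λ i j → U i j * nb weight i j + (3 * (P * P) + 12 * T * P * M))
          ≡⟨ ∑²-+ n (λ i j → U i j * nb weight i j) (λ _ _ → 3 * (P * P) + 12 * T * P * M) ⟩
      ∑² n (λ i j → U i j * nb weight i j) + ∑² n (λ _ _ → 3 * (P * P) + 12 * T * P * M) ∎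

-- Reflections of the grid

AlmostSuperharmonic : ℕ → Field → Set
AlmostSuperharmonic n u = ∀ i j → i < n → j < n → nb u i j ≤ 4 * u (suc i) (suc j) + 3

-- The equations name the reflections of a vertex and its two neighbours on a line, so that `nb` of
-- a mirrored field becomes `nb` of the field with two summands exchanged.
mirror : ∀ {n i} → i < n → Σ ℕ λ b → b < n × suc n ∸ i ≡ suc (suc b) × n ∸ i ≡ suc b × n ∸ suc i ≡ b
mirror {suc n} {zero} _ = n , ≤-refl , refl , refl , refl
mirror {suc n} {suc i} (s≤s i<n) with mirror i<n
... | b , b<n , eqs = b , m<n⇒m<1+n b<n , eqs

mirrorˣ mirrorʸ : ℕ → Field → Field
mirrorˣ n u x y = u (suc n ∸ x) y
mirrorʸ n u x y = u x (suc n ∸ y)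

mirrorˣ-almost : ∀ {n u} → AlmostSuperharmonic n u → AlmostSuperharmonic n (mirrorˣ n u)
mirrorˣ-almost {n} {u} almost i j i<n j<n with b , b<n , e₀ , e₁ , e₂ ← mirror i<n rewrite e₀ | e₁ | e₂ =
  subst (_≤ 4 * u (suc b) (suc j) + 3) (cong (_+ (u (suc b) j + u (suc b) (suc (suc j))))
      (+-comm (u b (suc j)) (u (suc (suc b)) (suc j))))
    (almost b j b<n j<n)

mirrorʸ-almost : ∀ {n u} → AlmostSuperharmonic n u → AlmostSuperharmonic n (mirrorʸ n u)
mirrorʸ-almost {n} {u} almost i j i<n j<n with b , b<n , e₀ , e₁ , e₂ ← mirror j<n rewrite e₀ | e₁ | e₂ =
  subst (_≤ 4 * u (suc i) (suc b) + 3) (cong (u i (suc b) + u (suc (suc i)) (suc b) +_)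
      (+-comm (u (suc i) b) (u (suc i) (suc (suc b)))))
    (almost i b i<n b<n)

mirror-near : ∀ {n x} → InGrid n x → ¬ 2 * x ≤ suc n → InGrid n (suc n ∸ x) × 2 * (suc n ∸ x) ≤ suc n ×
    suc n ∸ (suc n ∸ x) ≡ x
mirror-near {n} {x} x-in@(inside {i} i<n) far = mirrored , ≤-by 0
    (+-mono-≤ (<⇒≤ (≰⇒> far)) (≤-reflexive (cong (2 *_) split))) (ring (suc n ∸ x) x (suc n)) , m∸[m∸n]≡n x≤N
  where
  x≤N : x ≤ suc n
  x≤N = m<n⇒m<1+n i<n
  split : suc n ∸ x + x ≡ suc n
  split = m∸n+n≡m x≤N
  mirrored : InGrid n (suc n ∸ x)
  mirrored with b , b<n , _ , e₁ , _ ← mirror i<n rewrite e₁ = inside b<n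
  ring : ∀ r x N → 2 * r + (2 * x + 2 * N) + 0 ≡ N + (N + 2 * (r + x))
  ring = solve-∀

-- Bounds on the odometer and on the number of grains

-- With n + 1 ≈ 22h, the choice T = 7h, α = 20h² satisfies α + 9T² ≤ 3T(n + 1), and the box [7h, n+1−7h]² is
-- so small that it lies within √3/2 times T of its centre (11h, 11h).
module MassBound (n h K : ℕ) (22h≤N : 22 * h ≤ suc n) (N≤ : suc n ≤ 22 * h + 21) (h-large : 84 ≤ h)
    (n≤2^K : n ≤ 2 ^ K) where

  private
    α T : ℕ
    α = 20 * (h * h)
    T = 7 * h

    1≤h : 1 ≤ h
    1≤h = ≤-trans (s≤s z≤n) h-large

    1≤T : 1 ≤ T
    1≤T = *-mono-≤ {1} {7} (s≤s z≤n) 1≤h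

    room : α + 9 * (T * T) ≤ 3 * (T * suc n)
    room = ≤-by (h * h) (*-monoʳ-≤ (21 * h) 22h≤N) (ring h (suc n))
      where
      ring : ∀ h N → 20 * (h * h) + 9 * (7 * h * (7 * h)) + 21 * h * N + h * h ≡ 3 * (7 * h * N) + 21 * h * (22 * h)
      ring = solve-∀

  open Weighting α T n 1≤T room public

  P≤ : P ≤ 11592 * (h * h * h)
  P≤ = begin
    P
        ≤⟨ +-monoʳ-≤ cubic-top (*-monoʳ-≤ (3 * T) (*-mono-≤ N≤23h N≤23h)) ⟩
    7 * h * (20 * (h * h) + 7 * h * (7 * h)) + 3 * (7 * h) * (23 * h * (23 * h)) ≡⟨ ring h ⟩
    11592 * (h * h * h)                                    ∎
    where
    open ≤-Reasoning
    ring : ∀ h → 7 * h * (20 * (h * h) + 7 * h * (7 * h)) + 3 * (7 * h) * (23 * h * (23 * h)) ≡ 11592 * (h * h * h)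
    ring = solve-∀
    N≤23h : suc n ≤ 23 * h
    N≤23h = ≤-trans N≤ (≤-by 63 h-large (ring₂ h))
      where
      ring₂ : ∀ h → 22 * h + 21 + h + 63 ≡ 23 * h + 84
      ring₂ = solve-∀

  Bounded : ℕ → Field → Set
  Bounded M u = ∀ x y → Flat x → Flat y → u x y ≤ M

  -- A box coordinate differs from 11h by at most 4h + 21, which is at most 17h/4 since h ≥ 84 = 4 ·
  -- 21. As 17² = 289 ≤ 2 · 147 and 147 = 3 · 7², the two coordinates together meet the requirement
  -- 4 · dist² ≤ 3T² of `harnack`.
  sqdist-centre : ∀ {x} → Flat x → 8 * sqdist x (11 * h) ≤ 147 * (h * h) × 8 * sqdist (11 * h) x ≤ 147 * (h * h)
  sqdist-centre {x} (T≤x , x+T≤N) = bound , subst (λ d → 8 * (d * d) ≤ 147 * (h * h)) (∣-∣-comm x (11 * h)) bound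
    where
    x≤ : x ≤ 15 * h + 21
    x≤ = +-cancelʳ-≤ T x (15 * h + 21) (≤-trans x+T≤N (≤-trans N≤ (≤-reflexive (ring h))))
      where
      ring : ∀ h → 22 * h + 21 ≡ 15 * h + 21 + 7 * h
      ring = solve-∀
    spread : ∣ x - 11 * h ∣ ≤ 4 * h + 21
    spread with ∣m-n∣≡[m∸n]∨[n∸m] x (11 * h)
    ... | inj₁ eq = ≤-trans (≤-reflexive eq) (m≤n+o⇒m∸n≤o x (11 * h) (≤-trans x≤ (≤-reflexive (ring h))))
      where
      ring : ∀ h → 15 * h + 21 ≡ 11 * h + (4 * h + 21)
      ring = solve-∀
    ... | inj₂ eq = ≤-trans (≤-reflexive eq) (m≤n+o⇒m∸n≤o (11 * h) x (≤-by 21 T≤x (ring h x)))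
      where
      ring : ∀ h x → 11 * h + x + 21 ≡ x + (4 * h + 21) + 7 * h
      ring = solve-∀
    scaled : 4 * ∣ x - 11 * h ∣ ≤ 17 * h
    scaled = ≤-by 0 (+-mono-≤ (*-monoʳ-≤ 4 spread) h-large) (ring ∣ x - 11 * h ∣ h)
      where
      ring : ∀ d h → 4 * d + (4 * (4 * h + 21) + h) + 0 ≡ 17 * h + (4 * d + 84)
      ring = solve-∀
    bound : 8 * sqdist x (11 * h) ≤ 147 * (h * h)
    bound = *-cancelˡ-≤ 2 (begin
      2 * (8 * (d * d))       ≡⟨ ring₁ d ⟩
      4 * d * (4 * d)         ≤⟨ *-mono-≤ scaled scaled ⟩
      17 * h * (17 * h)       ≤⟨ ≤-by (5 * (h * h)) ≤-refl (ring₂ h) ⟩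
      2 * (147 * (h * h))     ∎)
      where
      open ≤-Reasoning
      d = ∣ x - 11 * h ∣
      ring₁ : ∀ d → 2 * (8 * (d * d)) ≡ 4 * d * (4 * d)
      ring₁ = solve-∀
      ring₂ : ∀ h → 17 * h * (17 * h) + 0 + 5 * (h * h) ≡ 2 * (147 * (h * h)) + 0
      ring₂ = solve-∀

  close : ∀ x y → 8 * x ≤ 147 * (h * h) → 8 * y ≤ 147 * (h * h) → 4 * (x + y) ≤ 3 * (T * T)
  close x y x≤ y≤ = *-cancelˡ-≤ 2 (≤-by 0 (+-mono-≤ x≤ y≤) (ring h x y))
    where
    ring : ∀ h x y → 2 * (4 * (x + y)) + (147 * (h * h) + 147 * (h * h)) + 0 ≡
        2 * (3 * (7 * h * (7 * h))) + (8 * x + 8 * y)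
    ring = solve-∀

  centre-flat : Flat (11 * h)
  centre-flat = *-monoˡ-≤ h (m≤m+n 7 4) , ≤-trans (≤-by (4 * h) ≤-refl (ring h)) 22h≤N
    where
    ring : ∀ h → 11 * h + 7 * h + 0 + 4 * h ≡ 22 * h + 0
    ring = solve-∀

  Flat⇒≤N : ∀ {x} → Flat x → x ≤ suc n
  Flat⇒≤N {x} (_ , x+T≤N) = m+n≤o⇒m≤o x x+T≤N

  log-factor : ℕ
  log-factor = 12 * (K + K) + 24

  T²≤ : T * T ≤ 2 ^ (K + K)
  T²≤ = ≤-trans (*-mono-≤ T≤2^K T≤2^K) (≤-reflexive (sym (^-distribˡ-+-* 2 K K)))
    where
    T≤2^K : T ≤ 2 ^ K
    T≤2^K = ≤-trans (s≤s⁻¹ (≤-trans (≤-by (4 * h) (≤-trans 1≤h (m≤m+n h (10 * h))) (ring h)) 22h≤N)) n≤2^K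
      where
      ring : ∀ h → suc (7 * h) + (h + 10 * h) + 4 * h ≡ 22 * h + 1
      ring = solve-∀

  2≤T : 2 ≤ T
  2≤T = ≤-trans (m≤m+n 2 5) (*-monoʳ-≤ 7 1≤h)

  -- Two points of the box can be too far apart for one application of harnack, but both are close to the centre.
  spread-from-maximum : ∀ v m → Superharmonic n v → ∀ x₀ y₀ → Flat x₀ → Flat y₀ →
    log-factor * (log-factor * m) ≤ v x₀ y₀ → ∀ x y → Flat x → Flat y → m ≤ v x y
  spread-from-maximum v m sup x₀ y₀ fx₀@(T≤x₀ , x₀+T≤) fy₀@(T≤y₀ , y₀+T≤) large x y fx fy =
    harnack n v sup (11 * h) (11 * h) T (proj₁ centre-flat) (proj₁ centre-flat) (proj₂ centre-flat)
        (proj₂ centre-flat)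
      (K + K) m T²≤ 2≤T at-centre x y (Flat⇒≤N fx) (Flat⇒≤N fy)
          (close (sqdist x (11 * h)) (sqdist y (11 * h)) (proj₁ (sqdist-centre fx)) (proj₁ (sqdist-centre fy)))
    where
    at-centre : log-factor * m ≤ v (11 * h) (11 * h)
    at-centre = harnack n v sup x₀ y₀ T T≤x₀ T≤y₀ x₀+T≤ y₀+T≤ (K + K) (log-factor * m) T²≤ 2≤T large
      (11 * h) (11 * h) (Flat⇒≤N centre-flat) (Flat⇒≤N centre-flat)
          (close (sqdist (11 * h) x₀) (sqdist (11 * h) y₀) (proj₂ (sqdist-centre fx₀)) (proj₂ (sqdist-centre fy₀)))

  module _ (c : ℕ) (P≤ch³ : P ≤ c * (h * h * h)) where

    -- `level` is more than a zero of u allows as a lower bound of v on the box, and `cutoff` allows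
    -- for two Harnack steps above it. The constant of P ≤ ch³ stays a variable, which keeps a large
    -- numeral out of the polynomial identities.
    level cutoff : ℕ
    level = suc K * (h * h) * (c * c) + 1
    cutoff = log-factor * (log-factor * level)

    module _ (u : Field) (almost : AlmostSuperharmonic n u) where

      private
        v : Field
        -- Stable heights leave a defect of up to 3; four copies of `exit-bound` gain 4, hence
        -- strictness by 1.
        v x y = u x y + 4 * exit-bound K x y

        v-strict : StrictlySuperharmonic n v
        v-strict i j i<n j<n = ≤-by 0 (+-mono-≤ (almost i j i<n j<n)
            (*-monoʳ-≤ 4 (exit-bound-strict K i j (≤-trans i<n n≤2^K) (≤-trans j<n n≤2^K))))
          (trans (cong (λ s → s + 1 + (4 * u (suc i) (suc j) + 3 + 4 * (4 * exit-bound K (suc i) (suc j))) + 0)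
                   (trans (nb-+ u (λ x y → 4 * exit-bound K x y) i j)
                       (cong (nb u i j +_) (nb-* 4 (exit-bound K) i j))))
                 (ring (nb u i j) (nb (exit-bound K) i j) (u (suc i) (suc j)) (exit-bound K (suc i) (suc j))))
          where
          ring : ∀ a b c d → a + 4 * b + 1 + (4 * c + 3 + 4 * (4 * d)) + 0 ≡ 4 * (c + 4 * d) + (a + 4 * (b + 1))
          ring = solve-∀

        v-super : Superharmonic n v
        v-super i j i<n j<n = m+n≤o⇒m≤o (nb v i j) (v-strict i j i<n j<n)

      -- At a zero of u only the exit term of v remains, at most 32(K + 1)ab, while the weight is at
      -- least α²ab. After cancelling ab the contradiction is independent of the distance to the
      -- corner.
      level-too-high : ∀ {a b} → InGrid n a → InGrid n b → 2 * a ≤ suc n → 2 * b ≤ suc n → u a b ≡ 0 →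
        ¬ (∀ x y → Flat x → Flat y → level ≤ v x y)
      level-too-high {a@(suc i)} {b@(suc j)} (inside _) (inside _) 2a≤N 2b≤N u≡0 high = <⇒≱ gap
          (*-cancelʳ-≤ _ _ (a * b) (begin
        level * (α * α) * (a * b)                    ≡⟨ ring₁ level α a b ⟩
        level * (α * a * (α * b))
            ≤⟨ *-monoʳ-≤ level (*-mono-≤ (αx≤profile αN≤ 2a≤N) (αx≤profile αN≤ 2b≤N)) ⟩
        level * weight a b                           ≤⟨ lower-bound v level v-strict high a b ⟩
        P * P * v a b                                ≡⟨ cong (λ e → P * P * (e + 4 * exit-bound K a b)) u≡0 ⟩
        P * P * (4 * exit-bound K a b)
            ≤⟨ *-mono-≤ (*-mono-≤ P≤ch³ P≤ch³) (*-monoʳ-≤ 4 (exit-bound≤ K a b)) ⟩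
        c * (h * h * h) * (c * (h * h * h)) * (4 * (suc K * (8 * (a * b))))
            ≡⟨ ring₂ (c * (h * h * h)) (suc K) (a * b) ⟩
        32 * (suc K * (c * (h * h * h) * (c * (h * h * h)))) * (a * b) ∎))
        where
        open ≤-Reasoning
        ring₁ : ∀ m α a b → m * (α * α) * (a * b) ≡ m * (α * a * (α * b))
        ring₁ = solve-∀
        ring₂ : ∀ q k s → q * q * (4 * (k * (8 * s))) ≡ 32 * (k * (q * q)) * s
        ring₂ = solve-∀
        αN≤ : α * suc n ≤ 2 * cubic-top
        αN≤ = ≤-by (20 * (h * h * h) + 486 * (h * h * h))
            (*-monoʳ-≤ (20 * (h * h)) (≤-trans N≤ (+-monoʳ-≤ (22 * h) (≤-trans (m≤m+n 21 63) h-large))))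
                (ring h (suc n))
          where
          ring : ∀ h N → 20 * (h * h) * N + 20 * (h * h) * (22 * h + h) + (20 * (h * h * h) + 486 * (h * h * h))
              ≡ 2 * (7 * h * (20 * (h * h) + 7 * h * (7 * h))) + 20 * (h * h) * N
          ring = solve-∀
        -- Here α² = 400h⁴ outweighs the factor 32, and the + 1 in `level` makes the inequality
        -- strict.
        gap : 32 * (suc K * (c * (h * h * h) * (c * (h * h * h)))) < level * (α * α)
        gap = <-≤-trans (m<m+n _ {h * h * (h * h)} (*-mono-≤ (*-mono-≤ 1≤h 1≤h) (*-mono-≤ 1≤h 1≤h)))
          (≤-by (368 * (suc K * (c * (h * h * h) * (c * (h * h * h)))) + 399 * (h * h * (h * h))) ≤-refl
              (ring h (suc K) c))
          where
          ring : ∀ h k c → 32 * (k * (c * (h * h * h) * (c * (h * h * h)))) + h * h * (h * h) + 0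
              + (368 * (k * (c * (h * h * h) * (c * (h * h * h)))) + 399 * (h * h * (h * h)))
            ≡ (k * (h * h) * (c * c) + 1) * (20 * (h * h) * (20 * (h * h))) + 0
          ring = solve-∀

      -- A single box value of v reaching `cutoff` would lift all of the box to `level`, so the
      -- upper bound follows from the impossibility of that lower bound.
      bounded-near-corner : ∀ {a b} → InGrid n a → InGrid n b → 2 * a ≤ suc n → 2 * b ≤ suc n → u a b ≡ 0 →
          Bounded cutoff u
      bounded-near-corner a-in b-in 2a≤N 2b≤N u≡0 x y fx fy with cutoff ≤? v x y
      ... | yes high = contradiction (spread-from-maximum v level v-super x y fx fy high)
          (level-too-high a-in b-in 2a≤N 2b≤N u≡0)
      ... | no low = ≤-trans (m≤m+n (u x y) _) (<⇒≤ (≰⇒> low))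

    Flat-mirror : ∀ {x} → Flat x → Flat (suc n ∸ x)
    Flat-mirror {x} (T≤x , x+T≤N) = m+n≤o⇒m≤o∸n T (subst (_≤ suc n) (+-comm x T) x+T≤N) ,
      ≤-trans (+-monoʳ-≤ (suc n ∸ x) T≤x) (≤-reflexive (m∸n+n≡m (m+n≤o⇒m≤o x x+T≤N)))

    module _ {u : Field} where

      unmirrorˣ : ∀ {M} → Bounded M (mirrorˣ n u) → Bounded M u
      unmirrorˣ bounded x y fx fy = subst (λ x → u x y ≤ _) (m∸[m∸n]≡n (Flat⇒≤N fx))
          (bounded (suc n ∸ x) y (Flat-mirror fx) fy)

      unmirrorʸ : ∀ {M} → Bounded M (mirrorʸ n u) → Bounded M u
      unmirrorʸ bounded x y fx fy = subst (λ y → u x y ≤ _) (m∸[m∸n]≡n (Flat⇒≤N fy))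
          (bounded x (suc n ∸ y) fx (Flat-mirror fy))

    bounded-left : ∀ {u} → AlmostSuperharmonic n u → ∀ {a b} → InGrid n a → InGrid n b → 2 * a ≤ suc n → u a b ≡
        0 → Bounded cutoff u
    bounded-left {u} almost {a} {b} a-in b-in 2a≤N u≡0 with 2 * b ≤? suc n
    ... | yes 2b≤N = bounded-near-corner u almost a-in b-in 2a≤N 2b≤N u≡0
    ... | no far with b′-in , 2b′≤N , back ← mirror-near b-in far =
      unmirrorʸ (bounded-near-corner (mirrorʸ n u) (mirrorʸ-almost {n} {u} almost) a-in b′-in 2a≤N 2b′≤N
          (trans (cong (u a) back) u≡0))

    bounded : ∀ {u} → AlmostSuperharmonic n u → ∀ {a b} → InGrid n a → InGrid n b → u a b ≡ 0 → Bounded cutoff u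
    bounded {u} almost {a} {b} a-in b-in u≡0 with 2 * a ≤? suc n
    ... | yes 2a≤N = bounded-left almost a-in b-in 2a≤N u≡0
    ... | no far with a′-in , 2a′≤N , back ← mirror-near a-in far =
      unmirrorˣ (bounded-left (mirrorˣ-almost {n} {u} almost) a′-in b-in 2a′≤N (trans (cong (λ a → u a b) back) u≡0))

    -- In orders of magnitude T is h, α is h², P is h³ and `cutoff` is h²(K + 1)³. Dividing
    -- `mass-bound` by α² leaves n²h²(K + 1)³, and h ≤ n. The constants are 84 = 12 · 7 from 12T and
    -- 576 = 24² from `log-factor` = 24(K + 1).
    transient-mass : ∀ (u μ : Field) → VanishesOutside n u →
      (∀ i j → i < n → j < n → μ i j + nb u i j ≤ 4 * u (suc i) (suc j) + 3) →
      ∀ {i j} → i < n → j < n → u (suc i) (suc j) ≡ 0 →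
      ∑² n μ ≤ n * n * (n * n) * (suc K * suc K * suc K) * (3 * (c * c) + 84 * 576 * (c * (c * c + 1)))
    transient-mass u μ u-out balance i<n j<n u≡0 = begin
      ∑² n μ
          ≤⟨ *-cancelʳ-≤ _ _ (h * h * (h * h)) {{>-nonZero (*-mono-≤ (*-mono-≤ 1≤h 1≤h) (*-mono-≤ 1≤h 1≤h))}} scaled ⟩
      n * n * (3 * (c * c) * (h * h) + 84 * c * cutoff) ≤⟨ *-monoʳ-≤ (n * n) (+-mono-≤ first second) ⟩
      n * n * (3 * (c * c) * (h * h * (k * k * k)) + 84 * c * (576 * ((h * h) * (k * k * k) * (c * c + 1))))
          ≡⟨ ring₁ (n * n) c (h * h) (k * k * k) ⟩
      n * n * (h * h) * (k * k * k) * D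
          ≤⟨ *-monoˡ-≤ D (*-monoˡ-≤ (k * k * k) (*-monoʳ-≤ (n * n) (*-mono-≤ h≤n h≤n))) ⟩
      n * n * (n * n) * (k * k * k) * D            ∎
      where
      open ≤-Reasoning
      k D : ℕ
      k = suc K
      D = 3 * (c * c) + 84 * 576 * (c * (c * c + 1))
      almost : AlmostSuperharmonic n u
      almost i j i<n j<n = ≤-trans (m≤n+m (nb u i j) (μ i j)) (balance i j i<n j<n)
      h≤n : h ≤ n
      h≤n = s≤s⁻¹ (≤-trans (≤-by (20 * h) 1≤h (ring h)) 22h≤N)
        where
        ring : ∀ h → suc h + h + 20 * h ≡ 22 * h + 1
        ring = solve-∀
      ring₁ : ∀ n c h k → n * (3 * (c * c) * (h * k) + 84 * c * (576 * (h * k * (c * c + 1)))) ≡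
          n * h * k * (3 * (c * c) + 84 * 576 * (c * (c * c + 1)))
      ring₁ = solve-∀
      first : 3 * (c * c) * (h * h) ≤ 3 * (c * c) * (h * h * (k * k * k))
      first = *-monoʳ-≤ (3 * (c * c)) (m≤m*n (h * h) (k * k * k))
      second : 84 * c * cutoff ≤ 84 * c * (576 * (h * h * (k * k * k) * (c * c + 1)))
      second = *-monoʳ-≤ (84 * c) (begin
        log-factor * (log-factor * level)            ≡⟨ ring₂ K level ⟩
        576 * (k * k * level)
            ≤⟨ *-monoʳ-≤ 576 (*-monoʳ-≤ (k * k)
                (+-monoʳ-≤ (k * (h * h) * (c * c)) (*-mono-≤ (s≤s {0} {K} z≤n) (*-mono-≤ 1≤h 1≤h)))) ⟩
        576 * (k * k * (k * (h * h) * (c * c) + k * (h * h))) ≡⟨ ring₃ k (h * h) (c * c) ⟩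
        576 * (h * h * (k * k * k) * (c * c + 1))    ∎)
        where
        ring₂ : ∀ K l → (12 * (K + K) + 24) * ((12 * (K + K) + 24) * l) ≡ 576 * ((1 + K) * (1 + K) * l)
        ring₂ = solve-∀
        ring₃ : ∀ k h c → 576 * (k * k * (k * h * c + k * h)) ≡ 576 * (h * (k * k * k) * (c + 1))
        ring₃ = solve-∀
      scaled : ∑² n μ * (h * h * (h * h)) ≤ n * n * (3 * (c * c) * (h * h) + 84 * c * cutoff) * (h * h * (h * h))
      scaled = begin
        ∑² n μ * (h * h * (h * h))      ≤⟨ *-monoʳ-≤ (∑² n μ) (*-mono-≤ (m≤n*m (h * h) 20) (m≤n*m (h * h) 20)) ⟩
        ∑² n μ * (α * α)                ≤⟨ mass-bound u μ cutoff u-out balance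
            (bounded almost (inside i<n) (inside j<n) u≡0) ⟩
        n * (n * (3 * (P * P) + 12 * T * P * cutoff))
            ≤⟨ *-monoʳ-≤ n (*-monoʳ-≤ n (+-mono-≤ (*-monoʳ-≤ 3 (*-mono-≤ P≤ch³ P≤ch³))
                (*-monoˡ-≤ cutoff (*-monoʳ-≤ (12 * T) P≤ch³)))) ⟩
        n * (n * (3 * (c * (h * h * h) * (c * (h * h * h))) + 12 * (7 * h) * (c * (h * h * h)) * cutoff))
            ≡⟨ ring₄ n h c cutoff ⟩
        n * n * (3 * (c * c) * (h * h) + 84 * c * cutoff) * (h * h * (h * h)) ∎
        where
        ring₄ : ∀ n h c M → n * (n * (3 * (c * (h * h * h) * (c * (h * h * h))) + 12 * (7 * h) *
            (c * (h * h * h)) * M))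
          ≡ n * n * (3 * (c * c) * (h * h) + 84 * c * M) * (h * h * (h * h))
        ring₄ = solve-∀

-- Heights after toppling and adding

height-tabulate : ∀ {n} (f : Fin n → Fin n → ℕ) a b → height (tabulate λ a → tabulate (f a)) a b ≡ f a b
height-tabulate f a b = trans (cong (λ row → lookup row b) (lookup∘tabulate (λ a → tabulate (f a)) a))
    (lookup∘tabulate (f a) b)

conf-ext : ∀ {n} {σ τ : Conf n} → (∀ a b → height σ a b ≡ height τ a b) → σ ≡ τ
conf-ext σ≡τ = vec-ext λ a → vec-ext λ b → σ≡τ a b
  where
  vec-ext : ∀ {A : Set} {n} {xs ys : Vec A n} → (∀ i → lookup xs i ≡ lookup ys i) → xs ≡ ys
  vec-ext {xs = xs} {ys} eq = trans (sym (tabulate∘lookup xs)) (trans (tabulate-cong eq) (tabulate∘lookup ys))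

⟦_⟧ : Bool → ℕ
⟦ b ⟧ = if b then 1 else 0

-- The vertex is given by zero-based indices and the point by coordinates of the closed grid, where
-- that vertex is (i + 1, j + 1).
δ : ℕ → ℕ → Field
δ i j x y = ⟦ suc i ≡ᵇ x ⟧ * ⟦ suc j ≡ᵇ y ⟧

≡ᵇ-comm : ∀ a b → (a ≡ᵇ b) ≡ (b ≡ᵇ a)
≡ᵇ-comm zero zero = refl
≡ᵇ-comm zero (suc b) = refl
≡ᵇ-comm (suc a) zero = refl
≡ᵇ-comm (suc a) (suc b) = ≡ᵇ-comm a b

≡ᵇ-refl : ∀ a → (a ≡ᵇ a) ≡ true
≡ᵇ-refl zero = refl
≡ᵇ-refl (suc a) = ≡ᵇ-refl a

≢⇒≡ᵇ : ∀ a b → a ≢ b → (a ≡ᵇ b) ≡ false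
≢⇒≡ᵇ zero zero a≢b = contradiction refl a≢b
≢⇒≡ᵇ zero (suc b) a≢b = refl
≢⇒≡ᵇ (suc a) zero a≢b = refl
≢⇒≡ᵇ (suc a) (suc b) a≢b = ≢⇒≡ᵇ a b λ eq → a≢b (cong suc eq)

-- Of the eight outcomes of the tests a = i, a + 1 = i, i + 1 = a only four occur. Indexing by the
-- Booleans lets the toppling rule compute in each of the sixteen cases for two coordinates.
data Offset : Bool → Bool → Bool → Set where
  same   : Offset true false false
  before : Offset false true false
  after  : Offset false false true
  far    : Offset false false false

offset : ∀ a i → Offset (a ≡ᵇ i) (suc a ≡ᵇ i) (suc i ≡ᵇ a)
offset zero zero = same
offset zero (suc zero) = before
offset zero (suc (suc i)) = far
offset (suc zero) zero = after
offset (suc (suc a)) zero = far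
offset (suc a) (suc i) = offset a i

topple-cases : ∀ {p r l q u d} → Offset p r l → Offset q u d → ∀ h → (p ∧ q ≡ true → 4 ≤ h) →
  (if p ∧ q then h ∸ 4 else (if (p ∧ (u ∨ d)) ∨ (q ∧ (r ∨ l)) then suc h else h)) + 4 * (⟦ p ⟧ * ⟦ q ⟧) ≡
  h + ((⟦ l ⟧ * ⟦ q ⟧ + ⟦ r ⟧ * ⟦ q ⟧) + (⟦ p ⟧ * ⟦ d ⟧ + ⟦ p ⟧ * ⟦ u ⟧))
topple-cases same same h 4≤h = trans (m∸n+n≡m (4≤h refl)) (sym (+-identityʳ h))
topple-cases same before h _ = trans (+-identityʳ (suc h)) (+-comm 1 h)
topple-cases same after h _ = trans (+-identityʳ (suc h)) (+-comm 1 h)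
topple-cases before same h _ = trans (+-identityʳ (suc h)) (+-comm 1 h)
topple-cases after same h _ = trans (+-identityʳ (suc h)) (+-comm 1 h)
topple-cases same far h _ = refl
topple-cases far same h _ = refl
topple-cases before before h _ = refl
topple-cases before after h _ = refl
topple-cases before far h _ = refl
topple-cases after before h _ = refl
topple-cases after after h _ = refl
topple-cases after far h _ = refl
topple-cases far before h _ = refl
topple-cases far after h _ = refl
topple-cases far far h _ = refl

nb-δ : ∀ i j a b → nb (δ i j) a b ≡
  (⟦ suc i ≡ᵇ a ⟧ * ⟦ b ≡ᵇ j ⟧ + ⟦ suc a ≡ᵇ i ⟧ * ⟦ b ≡ᵇ j ⟧) +
      (⟦ a ≡ᵇ i ⟧ * ⟦ suc j ≡ᵇ b ⟧ + ⟦ a ≡ᵇ i ⟧ * ⟦ suc b ≡ᵇ j ⟧)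
nb-δ i j a b rewrite ≡ᵇ-comm i a | ≡ᵇ-comm j b | ≡ᵇ-comm i (suc a) | ≡ᵇ-comm j (suc b) = refl

δ-sym : ∀ i j a b → δ i j (suc a) (suc b) ≡ ⟦ a ≡ᵇ i ⟧ * ⟦ b ≡ᵇ j ⟧
δ-sym i j a b rewrite ≡ᵇ-comm i a | ≡ᵇ-comm j b = refl

δ-here : ∀ i j → δ i j (suc i) (suc j) ≡ 1
δ-here i j rewrite ≡ᵇ-refl i | ≡ᵇ-refl j = refl

δ-away : ∀ i j x y → ¬ (x ≡ suc i × y ≡ suc j) → δ i j x y ≡ 0
δ-away i j x y away with suc i ≟ x
... | no i≢x rewrite ≢⇒≡ᵇ (suc i) x i≢x = refl
... | yes refl with suc j ≟ y
...   | no j≢y rewrite ≢⇒≡ᵇ (suc j) y j≢y = *-zeroʳ ⟦ suc i ≡ᵇ suc i ⟧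
...   | yes refl = contradiction (refl , refl) away

nb-δ-here : ∀ i j → nb (δ i j) i j ≡ 0
nb-δ-here i j rewrite ≢⇒≡ᵇ (suc i) i (λ ()) | ≢⇒≡ᵇ i (suc i) (λ ()) | ≢⇒≡ᵇ (suc j) j (λ ()) | ≢⇒≡ᵇ j (suc j) (λ ()) =
  cong₂ _+_ (*-zeroʳ ⟦ i ≡ᵇ i ⟧) (*-zeroʳ ⟦ i ≡ᵇ i ⟧)

module _ {n} (σ : Conf n) (i j : Fin n) where

  private
    δᵢⱼ : Field
    δᵢⱼ = δ (toℕ i) (toℕ j)

  height-toppleAt : 4 ≤ height σ i j → ∀ a b →
    height (toppleAt σ i j) a b + 4 * δᵢⱼ (suc (toℕ a)) (suc (toℕ b)) ≡ height σ a b + nb δᵢⱼ (toℕ a) (toℕ b)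
  height-toppleAt 4≤ a b
    rewrite height-tabulate (λ a b → if sameB a b i j then height σ a b ∸ 4 else
        (if adjB a b i j then suc (height σ a b) else height σ a b)) a b
          | δ-sym (toℕ i) (toℕ j) (toℕ a) (toℕ b) | nb-δ (toℕ i) (toℕ j) (toℕ a) (toℕ b) =
    topple-cases (offset (toℕ a) (toℕ i)) (offset (toℕ b) (toℕ j)) (height σ a b) at-vertex
    where
    at-vertex : (toℕ a ≡ᵇ toℕ i) ∧ (toℕ b ≡ᵇ toℕ j) ≡ true → 4 ≤ height σ a b
    at-vertex both with toℕ a ≟ toℕ i | toℕ b ≟ toℕ j
    ... | yes a≡i | yes b≡j rewrite toℕ-injective a≡i | toℕ-injective b≡j = 4≤
    ... | no a≢i | _ rewrite ≢⇒≡ᵇ _ _ a≢i = contradiction both λ ()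
    ... | yes a≡i | no b≢j rewrite a≡i | ≡ᵇ-refl (toℕ i) | ≢⇒≡ᵇ _ _ b≢j = contradiction both λ ()

  height-addAt : ∀ a b → height (addAt σ i j) a b ≡ height σ a b + δᵢⱼ (suc (toℕ a)) (suc (toℕ b))
  height-addAt a b
    rewrite height-tabulate (λ a b → if sameB a b i j then suc (height σ a b) else height σ a b) a b
          | δ-sym (toℕ i) (toℕ j) (toℕ a) (toℕ b) = cases (toℕ a ≡ᵇ toℕ i) (toℕ b ≡ᵇ toℕ j)
    where
    cases : ∀ p q → (if p ∧ q then suc (height σ a b) else height σ a b) ≡ height σ a b + ⟦ p ⟧ * ⟦ q ⟧
    cases true true = +-comm 1 (height σ a b)
    cases true false = sym (+-identityʳ _)
    cases false q = sym (+-identityʳ _)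

-- The abelian property

δᶠ-away : ∀ {n} (i j a b : Fin n) → ¬ (i ≡ a × j ≡ b) → δ (toℕ i) (toℕ j) (suc (toℕ a)) (suc (toℕ b)) ≡ 0
δᶠ-away i j a b away = δ-away (toℕ i) (toℕ j) _ _ λ (a≡i , b≡j) →
  away (toℕ-injective (sym (suc-injective a≡i)) , toℕ-injective (sym (suc-injective b≡j)))

module _ {n} (σ : Conf n) (i j a b : Fin n) (4≤ᵢ : 4 ≤ height σ i j) where

  topple-raises : ¬ (i ≡ a × j ≡ b) → height σ a b ≤ height (toppleAt σ i j) a b
  topple-raises away = begin
    height σ a b                                                        ≤⟨ m≤m+n _ _ ⟩
    height σ a b + nb (δ (toℕ i) (toℕ j)) (toℕ a) (toℕ b)               ≡⟨ height-toppleAt σ i j 4≤ᵢ a b ⟨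
    height (toppleAt σ i j) a b + 4 * δ (toℕ i) (toℕ j) (suc (toℕ a)) (suc (toℕ b))
        ≡⟨ cong (λ e → height (toppleAt σ i j) a b + 4 * e) (δᶠ-away i j a b away) ⟩
    height (toppleAt σ i j) a b + 0                                     ≡⟨ +-identityʳ _ ⟩
    height (toppleAt σ i j) a b                                         ∎
    where open ≤-Reasoning

-- Toppling with truncated subtraction adds a fixed Laplacian only where it is legal, so each of the
-- four topplings needs its hypothesis.
toppleAt-comm : ∀ {n} (σ : Conf n) i j a b → 4 ≤ height σ i j → 4 ≤ height σ a b →
  4 ≤ height (toppleAt σ i j) a b → 4 ≤ height (toppleAt σ a b) i j →
  toppleAt (toppleAt σ i j) a b ≡ toppleAt (toppleAt σ a b) i j
toppleAt-comm σ i j a b 4≤ᵢ 4≤ₐ 4≤ᵢₐ 4≤ₐᵢ = conf-ext λ x y →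
  ≡-by (cong₂ _+_ (cong₂ _+_ (height-toppleAt (toppleAt σ i j) a b 4≤ᵢₐ x y) (height-toppleAt σ i j 4≤ᵢ x y))
                  (cong₂ _+_ (sym (height-toppleAt (toppleAt σ a b) i j 4≤ₐᵢ x y))
                      (sym (height-toppleAt σ a b 4≤ₐ x y))))
    (ring (height (toppleAt (toppleAt σ i j) a b) x y) (height (toppleAt (toppleAt σ a b) i j) x y)
      (height (toppleAt σ i j) x y) (height (toppleAt σ a b) x y) (height σ x y)
      (4 * δ (toℕ i) (toℕ j) (suc (toℕ x)) (suc (toℕ y))) (4 * δ (toℕ a) (toℕ b) (suc (toℕ x)) (suc (toℕ y)))
      (nb (δ (toℕ i) (toℕ j)) (toℕ x) (toℕ y)) (nb (δ (toℕ a) (toℕ b)) (toℕ x) (toℕ y)))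
  where
  ring : ∀ ia ai i a h δi δa ni na → ia + (i + na + (h + ni) + (ai + δi + (a + δa))) ≡
      ai + (ia + δa + (i + δi) + (a + ni + (h + na)))
  ring = solve-∀

addAt-toppleAt-comm : ∀ {n} (σ : Conf n) i j a b → 4 ≤ height σ a b → 4 ≤ height (addAt σ i j) a b →
  toppleAt (addAt σ i j) a b ≡ addAt (toppleAt σ a b) i j
addAt-toppleAt-comm σ i j a b 4≤ 4≤⁺ = conf-ext λ x y →
  ≡-by (cong₂ _+_ (cong₂ _+_ (height-toppleAt (addAt σ i j) a b 4≤⁺ x y) (height-addAt σ i j x y))
                  (cong₂ _+_ (sym (height-addAt (toppleAt σ a b) i j x y)) (sym (height-toppleAt σ a b 4≤ x y))))
    (ring (height (toppleAt (addAt σ i j) a b) x y) (height (addAt (toppleAt σ a b) i j) x y)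
      (height (addAt σ i j) x y) (height (toppleAt σ a b) x y) (height σ x y)
      (δ (toℕ i) (toℕ j) (suc (toℕ x)) (suc (toℕ y))) (4 * δ (toℕ a) (toℕ b) (suc (toℕ x)) (suc (toℕ y)))
      (nb (δ (toℕ a) (toℕ b)) (toℕ x) (toℕ y)))
  where
  ring : ∀ ta at a t h δi δa na → ta + (a + na + (h + δi) + (at + (t + δa))) ≡
      at + (ta + δa + a + (t + δi + (h + na)))
  ring = solve-∀

addAt-raises : ∀ {n} (σ : Conf n) i j a b → height σ a b ≤ height (addAt σ i j) a b
addAt-raises σ i j a b = ≤-trans (m≤m+n _ _) (≤-reflexive (sym (height-addAt σ i j a b)))

-- Confluence and additions made one at a time

data TopplesIn {n : ℕ} : ℕ → Conf n → Conf n → Set where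
  done : ∀ {σ} → TopplesIn 0 σ σ
  topple : ∀ {N σ τ} (i j : Fin n) → 4 ≤ height σ i j → TopplesIn N (toppleAt σ i j) τ → TopplesIn (suc N) σ τ

count-topples : ∀ {n} {σ τ : Conf n} → Topples σ τ → ∃ λ N → TopplesIn N σ τ
count-topples done = 0 , done
count-topples (topple i j 4≤ rest) with N , rest′ ← count-topples rest = suc N , topple i j 4≤ rest′

forget-count : ∀ {n N} {σ τ : Conf n} → TopplesIn N σ τ → Topples σ τ
forget-count done = done
forget-count (topple i j 4≤ rest) = topple i j 4≤ (forget-count rest)

-- An unstable vertex only gains grains while others topple, so every stabilization topples it, and
-- its first toppling can be moved to the front.
confluence : ∀ {n N} {σ τ : Conf n} → TopplesIn N σ τ → Stable τ → ∀ a b → 4 ≤ height σ a b →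
  ∃ λ M → N ≡ suc M × TopplesIn M (toppleAt σ a b) τ
confluence done stable a b 4≤ = contradiction 4≤ (<⇒≱ (stable a b))
confluence {σ = σ} {τ} (topple {N} i j 4≤ᵢ rest) stable a b 4≤ₐ with i ≟ᶠ a ×-dec j ≟ᶠ b
... | yes (refl , refl) = N , refl , rest
... | no away with confluence rest stable a b 4≤ᵢₐ
  where
  4≤ᵢₐ : 4 ≤ height (toppleAt σ i j) a b
  4≤ᵢₐ = ≤-trans 4≤ₐ (topple-raises σ i j a b 4≤ᵢ away)
...   | M , refl , rest′ = suc M , refl , topple i j 4≤ₐᵢ
      (subst (λ ρ → TopplesIn M ρ τ) (toppleAt-comm σ i j a b 4≤ᵢ 4≤ₐ
          (≤-trans 4≤ₐ (topple-raises σ i j a b 4≤ᵢ away)) 4≤ₐᵢ) rest′)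
  where
  4≤ₐᵢ : 4 ≤ height (toppleAt σ a b) i j
  4≤ₐᵢ = ≤-trans 4≤ᵢ (topple-raises σ a b i j 4≤ₐ λ (a≡i , b≡j) → away (sym a≡i , sym b≡j))

data Adds {n : ℕ} : ℕ → Conf n → Conf n → Set where
  none : ∀ {σ} → Adds 0 σ σ
  add : ∀ {k σ ρ} (i j : Fin n) → Adds k (addAt σ i j) ρ → Adds (suc k) σ ρ

Adds-raise : ∀ {n k} {σ ρ : Conf n} → Adds k σ ρ → ∀ a b → height σ a b ≤ height ρ a b
Adds-raise none a b = ≤-refl
Adds-raise {σ = σ} (add i j rest) a b = ≤-trans (addAt-raises σ i j a b) (Adds-raise rest a b)

topple-Adds : ∀ {n k} {σ ρ : Conf n} a b → 4 ≤ height σ a b → Adds k σ ρ → Adds k (toppleAt σ a b) (toppleAt ρ a b)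
topple-Adds a b 4≤ none = none
topple-Adds {σ = σ} {ρ} a b 4≤ (add {k} i j rest) = add i j (subst (λ σ → Adds k σ (toppleAt ρ a b))
    (addAt-toppleAt-comm σ i j a b 4≤ 4≤⁺) (topple-Adds a b 4≤⁺ rest))
  where
  4≤⁺ : 4 ≤ height (addAt σ i j) a b
  4≤⁺ = ≤-trans 4≤ (addAt-raises σ i j a b)

stable? : ∀ {n} (σ : Conf n) → Stable σ ⊎ ∃₂ λ i j → 4 ≤ height σ i j
stable? σ with any? (λ i → any? (λ j → 4 ≤? height σ i j))
... | yes unstable = inj₂ unstable
... | no stable = inj₁ λ i j → ≰⇒> λ 4≤ → stable (i , j , 4≤)

-- A toppling legal for σ is legal for the higher ρ, so `confluence` removes it from the N topplings
-- of ρ. The decreasing counter also shows that σ stabilizes at all.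
stabilize-under : ∀ {n k} N {σ ρ τ : Conf n} → Adds k σ ρ → TopplesIn N ρ τ → Stable τ →
  ∃₂ λ σ′ ρ′ → Stabilizes σ σ′ × Adds k σ′ ρ′ × Topples ρ′ τ
stabilize-under N {σ} {ρ} {τ} adds topples stable with stable? σ
... | inj₁ σ-stable = σ , ρ , (done , σ-stable) , adds , forget-count topples
... | inj₂ (i , j , 4≤) with confluence topples stable i j (≤-trans 4≤ (Adds-raise adds i j))
...   | M , refl , topples′ with stabilize-under M (topple-Adds i j 4≤ adds) topples′ stable
...     | σ′ , ρ′ , (σ→σ′ , σ′-stable) , adds′ , ρ′→τ = σ′ , ρ′ , (topple i j 4≤ σ→σ′ , σ′-stable) , adds′ , ρ′→τ

-- Needed because the recurrence argument adds many grains before any toppling, whereas the process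
-- stabilizes after each grain.
one-at-a-time : ∀ {n} k {σ ρ τ : Conf n} → Adds k σ ρ → Topples ρ τ → Stable σ → Stable τ → Steps k σ τ
one-at-a-time zero none done _ _ = zero
one-at-a-time zero none (topple i j 4≤ _) σ-stable _ = contradiction 4≤ (<⇒≱ (σ-stable i j))
one-at-a-time (suc k) {σ} (add i j adds) topples σ-stable τ-stable
  with N , topples′ ← count-topples topples
  with σ′ , ρ′ , σ→σ′ , adds′ , ρ′→τ ← stabilize-under N adds topples′ τ-stable =
  suc (i , j , σ→σ′) (one-at-a-time k adds′ ρ′→τ (proj₂ σ→σ′) τ-stable)

∑ᶠ : ∀ {n} → (Fin n → ℕ) → ℕ
∑ᶠ {zero} f = 0
∑ᶠ {suc n} f = f fzero + ∑ᶠ (λ i → f (fsuc i))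

∑ᶠ-mono : ∀ {n} {f g : Fin n → ℕ} → (∀ i → f i ≤ g i) → ∑ᶠ f ≤ ∑ᶠ g
∑ᶠ-mono {zero} f≤g = z≤n
∑ᶠ-mono {suc n} f≤g = +-mono-≤ (f≤g fzero) (∑ᶠ-mono λ i → f≤g (fsuc i))

∑ᶠ-strict : ∀ {n} {f g : Fin n → ℕ} → (∀ i → f i ≤ g i) → ∀ i → f i < g i → ∑ᶠ f < ∑ᶠ g
∑ᶠ-strict f≤g fzero f<g = +-mono-<-≤ f<g (∑ᶠ-mono λ i → f≤g (fsuc i))
∑ᶠ-strict f≤g (fsuc i) f<g = +-mono-≤-< (f≤g fzero) (∑ᶠ-strict (λ i → f≤g (fsuc i)) i f<g)

-- `M` is fuel, bounding the number of grains still missing.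
raise : ∀ {n} M (σ ρ : Conf n) → (∀ a b → height σ a b ≤ height ρ a b) →
  ∑ᶠ (λ a → ∑ᶠ (λ b → height ρ a b ∸ height σ a b)) < M → ∃ λ k → Adds k σ ρ
raise (suc M) σ ρ σ≤ρ enough with any? (λ a → any? (λ b → height σ a b <? height ρ a b))
... | no none-below = 0 , subst (Adds 0 σ) (conf-ext λ a b →
    ≤-antisym (σ≤ρ a b) (≮⇒≥ λ σ<ρ → none-below (a , b , σ<ρ))) none
... | yes (i , j , σ<ρ) with raise M (addAt σ i j) ρ σ⁺≤ρ (<-≤-trans decreases (s≤s⁻¹ enough))
  where
  here : height (addAt σ i j) i j ≡ suc (height σ i j)
  here = trans (height-addAt σ i j i j) (trans (cong (height σ i j +_) (δ-here (toℕ i) (toℕ j)))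
      (+-comm (height σ i j) 1))
  σ⁺≤ρ : ∀ a b → height (addAt σ i j) a b ≤ height ρ a b
  σ⁺≤ρ a b with i ≟ᶠ a ×-dec j ≟ᶠ b
  ... | yes (refl , refl) = subst (_≤ height ρ i j) (sym here) σ<ρ
  ... | no away = ≤-trans (≤-reflexive (trans (height-addAt σ i j a b)
    (trans (cong (height σ a b +_) (δᶠ-away i j a b away)) (+-identityʳ _)))) (σ≤ρ a b)
  shrinks : ∀ a b → height ρ a b ∸ height (addAt σ i j) a b ≤ height ρ a b ∸ height σ a b
  shrinks a b = ∸-monoʳ-≤ (height ρ a b) (addAt-raises σ i j a b)
  decreases : ∑ᶠ (λ a → ∑ᶠ (λ b → height ρ a b ∸ height (addAt σ i j) a b)) <
      ∑ᶠ (λ a → ∑ᶠ (λ b → height ρ a b ∸ height σ a b))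
  decreases = ∑ᶠ-strict (λ a → ∑ᶠ-mono (shrinks a)) i (∑ᶠ-strict (shrinks i) j
    (∸-monoʳ-< (≤-reflexive (sym here)) (σ⁺≤ρ i j)))
...   | k , adds = suc k , add i j adds

-- Histories and recurrence

∑-indicator : ∀ n {i} → i < n → ∑ n (λ a → ⟦ i ≡ᵇ a ⟧) ≡ 1
∑-indicator (suc n) {i} (s≤s i≤n) with m≤n⇒m<n∨m≡n i≤n
... | inj₁ i<n rewrite ∑-indicator n i<n | ≢⇒≡ᵇ i n (<⇒≢ i<n) = refl
... | inj₂ refl rewrite ≡ᵇ-refl n = cong (_+ 1) (∑-zero n ≤-refl)
  where
  ∑-zero : ∀ m → m ≤ n → ∑ m (λ a → ⟦ n ≡ᵇ a ⟧) ≡ 0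
  ∑-zero zero _ = refl
  ∑-zero (suc m) m<n rewrite ≢⇒≡ᵇ n m (≢-sym (<⇒≢ m<n)) = cong (_+ 0) (∑-zero m (<⇒≤ m<n))

∑²-δ : ∀ n {i j} → i < n → j < n → ∑² n (λ a b → δ i j (suc a) (suc b)) ≡ 1
∑²-δ n {i} {j} i<n j<n = trans (∑-cong n λ a _ →
    trans (∑-*ˡ n (λ b → ⟦ j ≡ᵇ b ⟧) ⟦ i ≡ᵇ a ⟧) (cong (⟦ i ≡ᵇ a ⟧ *_) (∑-indicator n j<n)))
  (trans (∑-*ʳ n (λ a → ⟦ i ≡ᵇ a ⟧) 1) (cong (_* 1) (∑-indicator n i<n)))

∑²-zero : ∀ n → ∑² n (λ _ _ → 0) ≡ 0
∑²-zero n = trans (∑²-const n 0) (trans (cong (n *_) (*-zeroʳ n)) (*-zeroʳ n))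

later : Field → ℕ → Field
later T s x y = if ⌊ s <? T x y ⌋ then 1 else 0

later-yes : ∀ (T : Field) s x y → s < T x y → later T s x y ≡ 1
later-yes T s x y s<T with s <? T x y
... | yes _ = refl
... | no s≮T = contradiction s<T s≮T

later-no : ∀ (T : Field) s x y → T x y ≤ s → later T s x y ≡ 0
later-no T s x y T≤s with s <? T x y
... | yes s<T = contradiction T≤s (<⇒≱ s<T)
... | no _ = refl

later≤1 : ∀ (T : Field) s x y → later T s x y ≤ 1
later≤1 T s x y with s <? T x y
... | yes _ = ≤-refl
... | no _ = z≤n

later-antitone : ∀ (T : Field) {s t} → s ≤ t → ∀ x y → later T t x y ≤ later T s x y
later-antitone T {s} {t} s≤t x y with t <? T x y
... | no _ = z≤n
... | yes t<T = ≤-reflexive (sym (later-yes T s x y (≤-<-trans s≤t t<T)))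

stamp : ℕ → ℕ → ℕ → Field → Field
stamp i j t T x y = if ⌊ x ≟ suc i ×-dec y ≟ suc j ⌋ then t else T x y

data StampCase (i j t : ℕ) (T : Field) (x y : ℕ) : ℕ → Set where
  fresh : x ≡ suc i → y ≡ suc j → StampCase i j t T x y t
  old   : ¬ (x ≡ suc i × y ≡ suc j) → StampCase i j t T x y (T x y)

stamp-case : ∀ i j t T x y → StampCase i j t T x y (stamp i j t T x y)
stamp-case i j t T x y with x ≟ suc i ×-dec y ≟ suc j
... | yes (x≡ , y≡) = fresh x≡ y≡
... | no away = old away

-- An invariant of the whole process. `last` holds the time of the latest toppling of a vertex;
-- times start at 1, so 0 means that it never toppled.
record History {n} (k : ℕ) (σ : Conf n) : Set where
  field
    odometer additions last : Field
    clock : ℕ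
    balance : ∀ a b → height σ a b + 4 * odometer (suc (toℕ a)) (suc (toℕ b)) ≡
        additions (toℕ a) (toℕ b) + nb odometer (toℕ a) (toℕ b)
    total : ∑² n additions ≡ k
    last-inside : ∀ x y → 0 < last x y → InGrid n x × InGrid n y
    last≤clock : ∀ x y → last x y ≤ clock
    last-injective : ∀ x y x′ y′ → 0 < last x y → last x y ≡ last x′ y′ → x ≡ x′ × y ≡ y′
    untoppled : ∀ x y → last x y ≡ 0 → odometer x y ≡ 0
    -- every neighbour that toppled after the last toppling of a vertex has left a grain there
    received : ∀ a b → 0 < last (suc (toℕ a)) (suc (toℕ b)) →
      nb (later last (last (suc (toℕ a)) (suc (toℕ b)))) (toℕ a) (toℕ b) ≤ height σ a b

history-empty : ∀ n → History 0 (empty n)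
history-empty n = record
  { odometer = λ _ _ → 0 ; additions = λ _ _ → 0 ; last = λ _ _ → 0 ; clock = 0
  ; balance = λ a b → trans (+-identityʳ _) (trans (cong (λ row → lookup row b) (lookup-replicate a _))
      (lookup-replicate b 0))
  ; total = ∑²-zero n
  ; last-inside = λ _ _ ()
  ; last≤clock = λ _ _ → z≤n
  ; last-injective = λ _ _ _ _ ()
  ; untoppled = λ _ _ _ → refl
  ; received = λ _ _ ()
  }

history-add : ∀ {n k} {σ : Conf n} i j → History k σ → History (suc k) (addAt σ i j)
history-add {n} {k} {σ} i j R = record
  { odometer = odometer ; additions = λ a b →
      additions a b + δ (toℕ i) (toℕ j) (suc a) (suc b) ; last = last ; clock = clock
  ; balance = λ a b → ≡-by (cong₂ _+_ (height-addAt σ i j a b) (balance a b))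
      (ring (height (addAt σ i j) a b) (height σ a b) (δ (toℕ i) (toℕ j) (suc (toℕ a)) (suc (toℕ b)))
          (4 * odometer (suc (toℕ a)) (suc (toℕ b)))
        (additions (toℕ a) (toℕ b)) (nb odometer (toℕ a) (toℕ b)))
  ; total = trans (∑²-+ n additions (λ a b → δ (toℕ i) (toℕ j) (suc a) (suc b)))
      (trans (cong₂ _+_ total (∑²-δ n (toℕ<n i) (toℕ<n j))) (+-comm k 1))
  ; last-inside = last-inside ; last≤clock = last≤clock ; last-injective = last-injective ; untoppled = untoppled
  ; received = λ a b toppled → ≤-trans (received a b toppled) (addAt-raises σ i j a b)
  }
  where
  open History R
  ring : ∀ h′ h d u m b → h′ + u + (h + d + (m + b)) ≡ m + d + b + (h′ + (h + u))
  ring = solve-∀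

history-topple : ∀ {n k} {σ : Conf n} i j → 4 ≤ height σ i j → History k σ → History k (toppleAt σ i j)
history-topple {n} {k} {σ} i j 4≤ R = record
  { odometer = λ x y → odometer x y + δᵢⱼ x y ; additions = additions ; last = last′ ; clock = suc clock
  ; balance = λ a b → trans (≡-by (cong₂ _+_ (height-toppleAt σ i j 4≤ a b) (balance a b))
      (ring (height (toppleAt σ i j) a b) (height σ a b) (δᵢⱼ (suc (toℕ a)) (suc (toℕ b)))
          (nb δᵢⱼ (toℕ a) (toℕ b)) (odometer (suc (toℕ a)) (suc (toℕ b)))
        (additions (toℕ a) (toℕ b)) (nb odometer (toℕ a) (toℕ b))))
      (cong (additions (toℕ a) (toℕ b) +_) (sym (nb-+ odometer δᵢⱼ (toℕ a) (toℕ b))))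
  ; total = total
  ; last-inside = last-inside′
  ; last≤clock = last≤clock′
  ; last-injective = last-injective′
  ; untoppled = untoppled′
  ; received = received′
  }
  where
  open History R
  δᵢⱼ last′ : Field
  δᵢⱼ = δ (toℕ i) (toℕ j)
  last′ = stamp (toℕ i) (toℕ j) (suc clock) last
  cases : ∀ x y → StampCase (toℕ i) (toℕ j) (suc clock) last x y (last′ x y)
  cases = stamp-case (toℕ i) (toℕ j) (suc clock) last
  ring : ∀ h′ h d nd u m b → h′ + 4 * (u + d) + (h + nd + (m + b)) ≡ m + (b + nd) + (h′ + 4 * d + (h + 4 * u))
  ring = solve-∀
  last-inside′ : ∀ x y → 0 < last′ x y → InGrid n x × InGrid n y
  last-inside′ x y 0< with last′ x y | cases x y
  ... | _ | fresh refl refl = inside (toℕ<n i) , inside (toℕ<n j)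
  ... | _ | old _ = last-inside x y 0<
  last≤clock′ : ∀ x y → last′ x y ≤ suc clock
  last≤clock′ x y with last′ x y | cases x y
  ... | _ | fresh _ _ = ≤-refl
  ... | _ | old _ = m≤n⇒m≤1+n (last≤clock x y)
  last-injective′ : ∀ x y x′ y′ → 0 < last′ x y → last′ x y ≡ last′ x′ y′ → x ≡ x′ × y ≡ y′
  last-injective′ x y x′ y′ 0< eq with last′ x y | cases x y | last′ x′ y′ | cases x′ y′
  ... | _ | fresh refl refl | _ | fresh refl refl = refl , refl
  ... | _ | fresh _ _ | _ | old _ = contradiction eq (≢-sym (<⇒≢ (s≤s (last≤clock x′ y′))))
  ... | _ | old _ | _ | fresh _ _ = contradiction eq (<⇒≢ (s≤s (last≤clock x y)))
  ... | _ | old _ | _ | old _ = last-injective x y x′ y′ 0< eq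
  untoppled′ : ∀ x y → last′ x y ≡ 0 → odometer x y + δᵢⱼ x y ≡ 0
  untoppled′ x y eq with last′ x y | cases x y
  untoppled′ x y () | _ | fresh _ _
  ... | _ | old away = cong₂ _+_ (untoppled x y eq) (δ-away (toℕ i) (toℕ j) x y away)
  later′-zero : ∀ x y → later last′ (suc clock) x y ≡ 0
  later′-zero x y = later-no last′ (suc clock) x y (last≤clock′ x y)
  later′≤ : ∀ s x y → later last′ s x y ≤ later last s x y + δᵢⱼ x y
  later′≤ s x y with s <? last′ x y
  ... | no _ = z≤n
  ... | yes s< with last′ x y | cases x y
  ...   | _ | fresh refl refl = ≤-trans (≤-reflexive (sym (δ-here (toℕ i) (toℕ j)))) (m≤n+m _ (later last s x y))
  ...   | _ | old _ = ≤-trans (≤-reflexive (sym (later-yes last s x y s<))) (m≤m+n _ _)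
  -- Nothing is later than the newest stamp, so the vertex just toppled owes nothing. For any other
  -- vertex only the stamp at (i, j) has grown, and if (i, j) is a neighbour, the grain now arriving
  -- from it pays for that.
  received′ : ∀ a b → 0 < last′ (suc (toℕ a)) (suc (toℕ b)) →
    nb (later last′ (last′ (suc (toℕ a)) (suc (toℕ b)))) (toℕ a) (toℕ b) ≤ height (toppleAt σ i j) a b
  received′ a b 0< with last′ (suc (toℕ a)) (suc (toℕ b)) | cases (suc (toℕ a)) (suc (toℕ b))
  ... | _ | fresh _ _ = ≤-trans (≤-reflexive (nb-cong later′-zero (toℕ a) (toℕ b))) z≤n
  ... | _ | old away = begin
    nb (later last′ s) (toℕ a) (toℕ b)                       ≤⟨ nb-mono (later′≤ s) (toℕ a) (toℕ b) ⟩
    nb (λ x y → later last s x y + δᵢⱼ x y) (toℕ a) (toℕ b)  ≡⟨ nb-+ (later last s) δᵢⱼ (toℕ a) (toℕ b) ⟩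
    nb (later last s) (toℕ a) (toℕ b) + nb δᵢⱼ (toℕ a) (toℕ b)
        ≤⟨ +-monoˡ-≤ (nb δᵢⱼ (toℕ a) (toℕ b)) (received a b 0<) ⟩
    height σ a b + nb δᵢⱼ (toℕ a) (toℕ b)                    ≡⟨ height-toppleAt σ i j 4≤ a b ⟨
    height (toppleAt σ i j) a b + 4 * δᵢⱼ (suc (toℕ a)) (suc (toℕ b))
        ≡⟨ cong (λ e → height (toppleAt σ i j) a b + 4 * e) (δ-away (toℕ i) (toℕ j) _ _ away) ⟩
    height (toppleAt σ i j) a b + 0                          ≡⟨ +-identityʳ _ ⟩
    height (toppleAt σ i j) a b                              ∎
    where
    open ≤-Reasoning
    s = last (suc (toℕ a)) (suc (toℕ b))

history-topples : ∀ {n k} {σ τ : Conf n} → Topples σ τ → History k σ → History k τ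
history-topples done R = R
history-topples (topple i j 4≤ rest) R = history-topples rest (history-topple i j 4≤ R)

history-steps : ∀ {n k m} {σ τ : Conf n} → Steps k σ τ → History m σ → History (k + m) τ
history-steps zero R = R
history-steps {τ = τ} (suc {k} (i , j , topples , _) rest) R =
  subst (λ m → History m τ) (+-suc k _) (history-steps rest (history-topples topples (history-add i j R)))

steps-stable : ∀ {n k} {σ τ : Conf n} → Steps k σ τ → Stable σ → Stable τ
steps-stable zero stable = stable
steps-stable (suc (_ , _ , _ , stable) rest) _ = steps-stable rest stable

as-fin : ∀ {n x} → InGrid n x → Σ (Fin n) λ i → x ≡ suc (toℕ i)
as-fin (inside i<n) = fromℕ< i<n , cong suc (sym (toℕ-fromℕ< i<n))

-- Recurrence by burning in the order of last topplings

module _ {n k} {σ : Conf n} (R : History k σ) (stable : Stable σ)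
         (all-toppled : ∀ (a b : Fin n) → 0 < History.last R (suc (toℕ a)) (suc (toℕ b))) where

  open History R

  private
    L : ℕ → Field
    L = later last

    nb-L≤4 : ∀ s a b → nb (L s) a b ≤ 4
    nb-L≤4 s a b = nb-mono (later≤1 last s) a b

  -- σ plus the Laplacian of the indicator function of the vertices whose last toppling is later than s
  pending : ℕ → Conf n
  pending s = tabulate λ a → tabulate λ b → height σ a b + 4 * L s (suc (toℕ a)) (suc (toℕ b)) ∸ nb (L s)
      (toℕ a) (toℕ b)

  height-pending : ∀ s a b → height (pending s) a b + nb (L s) (toℕ a) (toℕ b) ≡
      height σ a b + 4 * L s (suc (toℕ a)) (suc (toℕ b))
  height-pending s a b = trans (cong (_+ nb (L s) (toℕ a) (toℕ b)) (height-tabulate _ a b)) (m∸n+n≡m enough)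
    where
    enough : nb (L s) (toℕ a) (toℕ b) ≤ height σ a b + 4 * L s (suc (toℕ a)) (suc (toℕ b))
    enough with s <? last (suc (toℕ a)) (suc (toℕ b))
    ... | yes _ = ≤-trans (nb-L≤4 s (toℕ a) (toℕ b)) (m≤n+m 4 (height σ a b))
    ... | no s≮ = ≤-trans (nb-mono (later-antitone last (≮⇒≥ s≮)) (toℕ a) (toℕ b))
                    (≤-trans (received a b (all-toppled a b)) (m≤m+n (height σ a b) 0))

  -- The vertex holds its height in σ plus 4 minus the number of neighbours with later stamps, and
  -- `received` says that σ covers this number. Since a vertex is not its own neighbour, the
  -- thresholds s and s + 1 count the same neighbours.
  pending-fire : ∀ s i j → last (suc (toℕ i)) (suc (toℕ j)) ≡ suc s →
    4 ≤ height (pending s) i j × toppleAt (pending s) i j ≡ pending (suc s)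
  pending-fire s i j last≡ = 4≤ , conf-ext λ a b → ≡-by
      (cong₂ _+_ (cong₂ _+_ (height-toppleAt (pending s) i j 4≤ a b) (height-pending s a b))
        (cong₂ _+_ (sym (height-pending (suc s) a b))
            (cong₂ _+_ (sym (nb-step (toℕ a) (toℕ b))) (cong (4 *_) (step (suc (toℕ a)) (suc (toℕ b)))))))
      (ring (height (toppleAt (pending s) i j) a b) (height (pending s) a b) (height (pending (suc s)) a b)
          (height σ a b)
        (δᵢⱼ (suc (toℕ a)) (suc (toℕ b))) (nb δᵢⱼ (toℕ a) (toℕ b)) (nb (L s) (toℕ a) (toℕ b))
            (nb (L (suc s)) (toℕ a) (toℕ b))
        (L s (suc (toℕ a)) (suc (toℕ b))) (L (suc s) (suc (toℕ a)) (suc (toℕ b))))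
    where
    δᵢⱼ : Field
    δᵢⱼ = δ (toℕ i) (toℕ j)
    ring : ∀ t h h⁺ σ d nd nl nl⁺ l l⁺ →
      t + (h + nd + (σ + 4 * l) + (h⁺ + nl⁺ + (nl + 4 * (l⁺ + d)))) ≡
      h⁺ + (t + 4 * d + (h + nl) + (σ + 4 * l⁺ + (nl⁺ + nd + 4 * l)))
    ring = solve-∀
    step : ∀ x y → L s x y ≡ L (suc s) x y + δᵢⱼ x y
    step x y with x ≟ suc (toℕ i) ×-dec y ≟ suc (toℕ j)
    ... | yes (refl , refl) = trans (later-yes last s (suc (toℕ i)) (suc (toℕ j)) (≤-reflexive (sym last≡)))
      (sym (cong₂ _+_ (later-no last (suc s) (suc (toℕ i)) (suc (toℕ j)) (≤-reflexive last≡))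
          (δ-here (toℕ i) (toℕ j))))
    ... | no away with s <? last x y
    ...   | no s≮ = sym (cong₂ _+_ (later-no last (suc s) x y (m≤n⇒m≤1+n (≮⇒≥ s≮))) (δ-away (toℕ i) (toℕ j) x y away))
    ...   | yes s< = sym (cong₂ _+_ (later-yes last (suc s) x y (≤∧≢⇒< s< λ eq → away (other eq)))
        (δ-away (toℕ i) (toℕ j) x y away))
      where
      other : suc s ≡ last x y → x ≡ suc (toℕ i) × y ≡ suc (toℕ j)
      other eq = last-injective x y (suc (toℕ i)) (suc (toℕ j)) (≤-trans (s≤s z≤n) s<) (trans (sym eq) (sym last≡))
    nb-step : ∀ a b → nb (L s) a b ≡ nb (L (suc s)) a b + nb δᵢⱼ a b
    nb-step a b = trans (nb-cong step a b) (nb-+ (L (suc s)) δᵢⱼ a b)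
    nb≤ : nb (L s) (toℕ i) (toℕ j) ≤ height σ i j
    nb≤ = subst₂ _≤_ (trans (cong (λ t → nb (L t) (toℕ i) (toℕ j)) last≡)
        (sym (trans (nb-step (toℕ i) (toℕ j))
            (trans (cong (nb (L (suc s)) (toℕ i) (toℕ j) +_) (nb-δ-here (toℕ i) (toℕ j))) (+-identityʳ _)))))
      refl (received i j (all-toppled i j))
    4≤ : 4 ≤ height (pending s) i j
    4≤ = ≤-by 0 (+-mono-≤ nb≤ (≤-reflexive (trans
        (cong (λ l → height σ i j + 4 * l) (sym
            (later-yes last s (suc (toℕ i)) (suc (toℕ j)) (≤-reflexive (sym last≡))))) (sym (height-pending s i j)))))
      (ring₂ (height (pending s) i j) (height σ i j) (nb (L s) (toℕ i) (toℕ j)))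
      where
      ring₂ : ∀ h σ nl → 4 + (σ + (h + nl)) + 0 ≡ h + (nl + (σ + 4))
      ring₂ = solve-∀

  -- A time up to `clock` is missing from `last` when the vertex that toppled then has toppled again
  -- since.
  pending-skip : ∀ s → (∀ (i j : Fin n) → last (suc (toℕ i)) (suc (toℕ j)) ≢ suc s) → pending s ≡ pending (suc s)
  pending-skip s never = conf-ext λ a b → trans (height-tabulate _ a b) (trans
      (cong₂ (λ l nl → height σ a b + 4 * l ∸ nl) (step (suc (toℕ a)) (suc (toℕ b))) (nb-cong step (toℕ a) (toℕ b)))
      (sym (height-tabulate _ a b)))
    where
    step : ∀ x y → L s x y ≡ L (suc s) x y
    step x y with s <? last x y
    ... | no s≮ = sym (later-no last (suc s) x y (m≤n⇒m≤1+n (≮⇒≥ s≮)))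
    ... | yes s< = sym (later-yes last (suc s) x y
        (≤∧≢⇒< s< λ eq → absent (last-inside x y (≤-trans (s≤s z≤n) s<)) eq))
      where
      absent : InGrid n x × InGrid n y → suc s ≢ last x y
      absent (x-in , y-in) eq with as-fin x-in | as-fin y-in
      ... | i , refl | j , refl = never i j (sym eq)

  pending-topples : ∀ d s → s + d ≡ clock → Topples (pending s) σ
  pending-topples zero s s≡ = subst (λ ρ → Topples ρ σ) (conf-ext λ a b → sym (trans (height-tabulate _ a b)
      (trans (cong₂ (λ l nl → height σ a b + 4 * l ∸ nl) (all-done (suc (toℕ a)) (suc (toℕ b)))
          (nb-cong all-done (toℕ a) (toℕ b))) (+-identityʳ _)))) done
    where
    all-done : ∀ x y → L s x y ≡ 0
    all-done x y = later-no last s x y (≤-trans (last≤clock x y) (≤-reflexive (trans (sym s≡) (+-identityʳ s))))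
  pending-topples (suc d) s s≡ with pending-topples d (suc s) (trans (sym (+-suc s d)) s≡) | any?
      (λ i → any? (λ j → last (suc (toℕ i)) (suc (toℕ j)) ≟ suc s))
  ... | rest | yes (i , j , eq) = let 4≤ , fired = pending-fire s i j eq in topple i j 4≤
      (subst (λ ρ → Topples ρ σ) (sym fired) rest)
  ... | rest | no never = subst (λ ρ → Topples ρ σ) (sym (pending-skip s λ i j eq → never (i , j , eq))) rest

  σ≤pending₀ : ∀ a b → height σ a b + 4 ≡ height (pending 0) a b + nb (L 0) (toℕ a) (toℕ b)
  σ≤pending₀ a b = sym (trans (height-pending 0 a b)
      (cong (λ l → height σ a b + 4 * l) (later-yes last 0 (suc (toℕ a)) (suc (toℕ b)) (all-toppled a b))))

  recurrent : Fin n → Recurrent σ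
  recurrent o with raise _ σ (pending 0) raises ≤-refl
    where
    raises : ∀ a b → height σ a b ≤ height (pending 0) a b
    raises a b = ≤-by 0 (+-mono-≤ (≤-reflexive (σ≤pending₀ a b)) (nb-L≤4 0 (toℕ a) (toℕ b)))
        (ring (height σ a b) (height (pending 0) a b) (nb (L 0) (toℕ a) (toℕ b)))
      where
      ring : ∀ s p l → s + (p + l + 4) + 0 ≡ p + (s + 4 + l)
      ring = solve-∀
  ... | suc k , adds = k , one-at-a-time (suc k) adds (pending-topples clock 0 refl) stable stable
  -- `Recurrent` asks for at least one step. Without an addition σ would equal `pending 0`, but at
  -- the corner one neighbour lies off the grid, so at most 3 of the 4 extra grains are taken away.
  ... | zero , adds = contradiction (unchanged adds) (corner-differs o)
    where
    unchanged : ∀ {ρ} → Adds 0 σ ρ → σ ≡ ρ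
    unchanged none = refl
    zeroth : ∀ {m} → Fin m → Σ (Fin m) λ z → toℕ z ≡ 0
    zeroth fzero = fzero , refl
    zeroth (fsuc _) = fzero , refl
    corner-differs : Fin n → σ ≢ pending 0
    corner-differs o σ≡ with z , z≡0 ← zeroth o = contradiction
      (+-cancelˡ-≡ (height σ z z) 4 _ (trans (σ≤pending₀ z z)
          (cong (λ ρ → height ρ z z + nb (L 0) (toℕ z) (toℕ z)) (sym σ≡))))
      (≢-sym (<⇒≢ (s≤s (+-mono-≤ (+-mono-≤ (≤-reflexive (west z≡0))
          (later≤1 last 0 (suc (suc (toℕ z))) (suc (toℕ z))))
              (+-mono-≤ (later≤1 last 0 (suc (toℕ z)) (toℕ z)) (later≤1 last 0 (suc (toℕ z)) (suc (suc (toℕ z)))))))))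
      where
      west : ∀ {x} → x ≡ 0 → L 0 x (suc (toℕ z)) ≡ 0
      west refl with 0 <? last 0 (suc (toℕ z))
      ... | no _ = refl
      ... | yes 0< with () ← proj₁ (last-inside 0 (suc (toℕ z)) 0<)

-- From transient configurations to the bound

empty-stable : ∀ n → Stable (empty n)
empty-stable n a b = subst (_< 4) (sym (trans (cong (λ row → lookup row b) (lookup-replicate a _))
    (lookup-replicate b 0))) (s≤s z≤n)

transient⇒untoppled : ∀ {n k} {σ : Conf n} (R : History k σ) → Stable σ → Fin n → ¬ Recurrent σ →
  ∃₂ λ (i j : Fin n) → History.last R (suc (toℕ i)) (suc (toℕ j)) ≡ 0
transient⇒untoppled R stable o transient with any? (λ i → any? (λ j → History.last R (suc (toℕ i)) (suc (toℕ j)) ≟ 0))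
... | yes found = found
... | no all-toppled = contradiction (recurrent R stable
    (λ a b → n≢0⇒n>0 λ last≡0 → all-toppled (a , b , last≡0)) o) transient

odometer-vanishes : ∀ {n k} {σ : Conf n} (R : History k σ) → VanishesOutside n (History.odometer R)
odometer-vanishes {n} R = record
  { west  = λ y → untoppled 0 y (n≤0⇒n≡0 (≮⇒≥ λ 0< → off-grid-0 (proj₁ (last-inside 0 y 0<))))
  ; east  = λ y → untoppled (suc n) y (n≤0⇒n≡0 (≮⇒≥ λ 0< → off-grid-N (proj₁ (last-inside (suc n) y 0<))))
  ; south = λ x → untoppled x 0 (n≤0⇒n≡0 (≮⇒≥ λ 0< → off-grid-0 (proj₂ (last-inside x 0 0<))))
  ; north = λ x → untoppled x (suc n) (n≤0⇒n≡0 (≮⇒≥ λ 0< → off-grid-N (proj₂ (last-inside x (suc n) 0<))))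
  }
  where
  open History R
  off-grid-0 : ¬ InGrid n 0
  off-grid-0 ()
  off-grid-N : ¬ InGrid n (suc n)
  off-grid-N (inside n<n) = <-irrefl refl n<n

history-balance : ∀ {n k} {σ : Conf n} (R : History k σ) → Stable σ → ∀ i j → i < n → j < n →
  History.additions R i j + nb (History.odometer R) i j ≤ 4 * History.odometer R (suc i) (suc j) + 3
history-balance {σ = σ} R stable i j i<n j<n =
  subst₂ (λ i j → additions i j + nb odometer i j ≤ 4 * odometer (suc i) (suc j) + 3) (toℕ-fromℕ< i<n)
      (toℕ-fromℕ< j<n)
    (≤-trans (≤-reflexive (sym (balance a b)))
        (≤-trans (+-monoˡ-≤ _ (s≤s⁻¹ (stable a b))) (≤-reflexive (+-comm 3 _))))
  where
  open History R
  a = fromℕ< i<n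
  b = fromℕ< j<n

n≤2^log : ∀ n → n ≤ 2 ^ suc ⌊log₂ n ⌋
n≤2^log n = ≮⇒≥ λ 2^<n → <⇒≱ (≤-reflexive (sym (⌊log₂[2^n]⌋≡n (suc ⌊log₂ n ⌋)))) (⌊log₂⌋-mono-≤ (<⇒≤ 2^<n))

-- The threshold 1848 = 22 · 84 ensures h ≥ 84. With L = log₂ n rounded down and K = L + 1, the
-- bound K + 1 ≤ 3L gives the factor 27 = 3³, and L³ ≤ L⁴ gives the stated power. The final + 1
-- makes the inequality strict.
transience-bound : ∀ c → 11592 ≤ c → ∀ n → 1848 ≤ n →
  TclAtMost n ((27 * (3 * (c * c) + 84 * 576 * (c * (c * c + 1))) + 1) * (n ^ 4 * ⌊log₂ n ⌋ ^ 4))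
transience-bound c 11592≤c n n-large k τ steps transient = begin-strict
  k                                                       ≡⟨ trans total (+-identityʳ k) ⟨
  ∑² n additions                                          ≤⟨ mass ⟩
  n * n * (n * n) * (suc K * suc K * suc K) * D           ≤⟨ *-monoˡ-≤ D (*-monoʳ-≤ (n * n * (n * n)) cube) ⟩
  n * n * (n * n) * (27 * (L * L * L * L)) * D
      <⟨ m<m+n _ (*-mono-≤ n^4>0 (*-mono-≤ (*-mono-≤ (*-mono-≤ 1≤L 1≤L) 1≤L) 1≤L)) ⟩
  n * n * (n * n) * (27 * (L * L * L * L)) * D + n * n * (n * n) * (L * L * L * L) ≡⟨ ring D n L ⟩
  (27 * D + 1) * (n ^ 4 * L ^ 4)                          ∎
  where
  open ≤-Reasoning
  K L D h : ℕ
  L = ⌊log₂ n ⌋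
  K = suc L
  D = 3 * (c * c) + 84 * 576 * (c * (c * c + 1))
  h = suc n / 22
  1≤n : 1 ≤ n
  1≤n = ≤-trans (s≤s z≤n) n-large
  1≤L : 1 ≤ L
  1≤L = ⌊log₂⌋-mono-≤ {2} (≤-trans (s≤s (s≤s z≤n)) n-large)
  R : History (k + 0) τ
  R = history-steps steps (history-empty n)
  open History R
  stable : Stable τ
  stable = steps-stable steps (empty-stable n)
  22h≤N : 22 * h ≤ suc n
  22h≤N = ≤-trans (≤-reflexive (*-comm 22 h)) (m/n*n≤m (suc n) 22)
  N≤ : suc n ≤ 22 * h + 21
  N≤ = ≤-trans (≤-reflexive (m≡m%n+[m/n]*n (suc n) 22))
      (≤-trans (+-mono-≤ (s≤s⁻¹ (m%n<n (suc n) 22)) (≤-reflexive (*-comm h 22))) (≤-reflexive (+-comm 21 (22 * h))))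
  h-large : 84 ≤ h
  h-large = /-monoˡ-≤ 22 (m≤n⇒m≤1+n n-large)
  open MassBound n h K 22h≤N N≤ h-large (n≤2^log n) using (P≤; transient-mass)
  mass : ∑² n additions ≤ n * n * (n * n) * (suc K * suc K * suc K) * D
  mass with i , j , last≡0 ← transient⇒untoppled R stable (fromℕ< 1≤n) transient =
    transient-mass c (≤-trans P≤ (*-monoˡ-≤ (h * h * h) 11592≤c)) odometer additions (odometer-vanishes R)
        (history-balance R stable)
      (toℕ<n i) (toℕ<n j) (untoppled (suc (toℕ i)) (suc (toℕ j)) last≡0)
  n^4>0 : 1 ≤ n * n * (n * n)
  n^4>0 = *-mono-≤ (*-mono-≤ 1≤n 1≤n) (*-mono-≤ 1≤n 1≤n)
  cube : suc K * suc K * suc K ≤ 27 * (L * L * L * L)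
  cube = ≤-trans (*-mono-≤ (*-mono-≤ k≤3L k≤3L) k≤3L)
      (≤-trans (≤-reflexive (ring₁ L)) (*-monoʳ-≤ 27 (m≤m*n (L * L * L) L {{>-nonZero 1≤L}})))
    where
    k≤3L : suc K ≤ 3 * L
    k≤3L = ≤-by 0 (*-monoʳ-≤ 2 1≤L) (ring₂ L)
      where
      ring₂ : ∀ L → 2 + L + 2 * L + 0 ≡ 3 * L + 2 * 1
      ring₂ = solve-∀
    ring₁ : ∀ L → 3 * L * (3 * L) * (3 * L) ≡ 27 * (L * L * L)
    ring₁ = solve-∀
  ring : ∀ D n L → n * n * (n * n) * (27 * (L * L * L * L)) * D + n * n * (n * n) * (L * L * L * L) ≡
      (27 * D + 1) * (n * (n * (n * (n * 1))) * (L * (L * (L * (L * 1)))))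
  ring = solve-∀

mainTheorem1 : ∃₂ λ (C N : ℕ) → ∀ n → N ≤ n → TclAtMost n (C * (n ^ 4 * ⌊log₂ n ⌋ ^ 4))
mainTheorem1 = 27 * (3 * (11592 * 11592) + 84 * 576 * (11592 * (11592 * 11592 + 1))) + 1 , 1848 ,
    transience-bound 11592 ≤-refl
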